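{- As $n\to\infty$, the threshold bias of the $(1:q)$ Budget $K_4$-Game on $K_n$ satisfies $$q_{K_4}^b(n)\le\left(5\cdot 2^{ -9/5}e^{2/5}+o(1)\right)n^{2/5}.$$
   Context: The $(1:q)$ Budget $K_4$-Game on the complete graph $K_n$ is played by Maker and Breaker, who take alternate turns, with Maker beginning. In her turn, Maker claims one previously unclaimed edge of $K_n$. In his turn, Breaker may claim an arbitrary number (possibly zero) of previously unclaimed edges of $K_n$, subject to the condition that at the end of his turn the total number of edges claimed by Breaker so far is at most $q$ times the total number of edges claimed by Maker so far. Maker wins if at some point she has claimed all six edges of a copy of $K_4$ in $K_n$. Breaker wins if he manages to claim at least one edge of each copy of $K_4$ in $K_n$. The threshold bias $q_{K_4}^b(n)$ is the smallest non-negative integer $q$ such that Breaker has a winning strategy in this game. Here $e$ denotes Euler's number. -}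

module Defs where

open import Data.Empty using (⊥; ⊥-elim; ⊥-elim-irr)
open import Data.Fin.Base using (Fin; _<_)
import Data.Fin.Properties as Fin
open import Data.Integer.Base as ℤ using (+_)
open import Data.List.Base using (List; []; _∷_; length; concatMap; map; allFin)
open import Data.List.Membership.Propositional using (_∈_; _∉_; lose)
open import Data.List.Membership.Propositional.Properties
  using (∈-allFin; ∈-concatMap⁺; ∈-map⁺)
import Data.List.Membership.DecPropositional as DecMembership
open import Data.List.Relation.Unary.All as All using (All)
open import Data.List.Relation.Unary.Any as Any using (Any; here; there; satisfied)
open import Data.Nat.Base as ℕ using (ℕ; zero; suc; NonZero; _!)
import Data.Nat.Properties as ℕ
open import Data.Product.Base using (∃; ∃-syntax; _×_; _,_; proj₁; proj₂)
open import Data.Rational.Base as ℚ using (ℚ; 0ℚ; 1ℚ; ½; _/_; NonNegative)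
import Data.Rational.Properties as ℚ
open import Data.Rational.Unnormalised.Base as ℚᵘ using (mkℚᵘ)
import Data.Rational.Unnormalised.Properties as ℚᵘ
open import Algebra.Definitions.RawSemiring ℚ.+-*-rawSemiring using (_^_)
open import Relation.Nullary using (Dec; yes; no; ¬_)
open import Relation.Nullary.Decidable using (map′; _×-dec_; ¬?)
open import Relation.Unary using (Decidable)
open import Relation.Binary.PropositionalEquality
  using (_≡_; refl; sym; cong; subst)

private variable n : ℕ

record Edge (n : ℕ) : Set where
  constructor edge
  field
    src tgt    : Fin n
    .src<tgt : src < tgt

-- Copies of K₄ in Kₙ correspond to vertex sets, listed in increasing order.
record K₄ (n : ℕ) : Set where
  constructor k₄
  field
    a b c d : Fin n
    .a<b : a < b
    .b<c : b < c
    .c<d : c < d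

edges : K₄ n → List (Edge n)
edges (k₄ a b c d a<b b<c c<d) =
    edge a b a<b
  ∷ edge a c (ℕ.<-trans a<b b<c)
  ∷ edge a d (ℕ.<-trans a<b (ℕ.<-trans b<c c<d))
  ∷ edge b c b<c
  ∷ edge b d (ℕ.<-trans b<c c<d)
  ∷ edge c d c<d
  ∷ []

-- The (1 : q) Budget K₄-game.  A position is a pair of lists M, B: the edges
-- claimed so far by Maker and by Breaker.

Free : (M B : List (Edge n)) → Edge n → Set
Free M B e = e ∉ M × e ∉ B

Blocked : List (Edge n) → Set
Blocked {n} B = (K : K₄ n) → Any (_∈ B) (edges K)

-- An element of AtMaker q M B (resp. AtBreaker q M B) is a winning strategy
-- tree for Breaker from the position (M, B) with Maker (resp. Breaker) to move.
-- Breaker's turn is played one edge at a time and closed by endTurn, which is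
-- where the budget is checked.  The premise of reply that a free edge exists
-- means that a full board is a win for Breaker only if it is blocked.
mutual
  data AtMaker {n} (q : ℕ) (M B : List (Edge n)) : Set where
    blocked : Blocked B → AtMaker q M B
    reply   : ∃ (Free M B) → (∀ e → Free M B e → AtBreaker q (e ∷ M) B) →
              AtMaker q M B

  data AtBreaker {n} (q : ℕ) (M B : List (Edge n)) : Set where
    claim   : ∀ e → Free M B e → AtBreaker q M (e ∷ B) → AtBreaker q M B
    endTurn : length B ℕ.≤ q ℕ.* length M → AtMaker q M B → AtBreaker q M B

BreakerWins : (n q : ℕ) → Set
BreakerWins n q = AtMaker {n} q [] []

-- The game is decidable, so the threshold bias is a function of n.

_≟ᴱ_ : (e f : Edge n) → Dec (e ≡ f)
edge i j _ ≟ᴱ edge k l _ with i Fin.≟ k | j Fin.≟ l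
... | yes refl | yes refl = yes refl
... | no i≢k   | _        = no λ { refl → i≢k refl }
... | yes _    | no j≢l   = no λ { refl → j≢l refl }

_∈?_ : (e : Edge n) (es : List (Edge n)) → Dec (e ∈ es)
_∈?_ = DecMembership._∈?_ _≟ᴱ_

edgesBetween : Fin n → Fin n → List (Edge n)
edgesBetween i j with i Fin.<? j
... | yes i<j = edge i j i<j ∷ []
... | no  _   = []

allEdges : (n : ℕ) → List (Edge n)
allEdges n = concatMap (λ i → concatMap (edgesBetween i) (allFin n)) (allFin n)

∈-edgesBetween : ∀ (i j : Fin n) .(p : i < j) → edge i j p ∈ edgesBetween i j
∈-edgesBetween i j p with i Fin.<? j
... | yes _   = here refl
... | no  i≮j = ⊥-elim-irr (i≮j p)

∈-allEdges : (e : Edge n) → e ∈ allEdges n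
∈-allEdges (edge i j p) =
  ∈-concatMap⁺ _ (lose (∈-allFin i)
    (∈-concatMap⁺ (edgesBetween i) (lose (∈-allFin j) (∈-edgesBetween i j p))))

free? : (M B : List (Edge n)) → Decidable (Free M B)
free? M B e = ¬? (e ∈? M) ×-dec ¬? (e ∈? B)

all-dec : {P : Edge n → Set} → Decidable P → Dec (∀ e → P e)
all-dec P? = map′ (λ ps e → All.lookup ps (∈-allEdges e))
                  (λ f → All.tabulate λ {e} _ → f e) (All.all? P? (allEdges _))

any-dec : {P : Edge n → Set} → Decidable P → Dec (∃ P)
any-dec P? = map′ satisfied (λ (e , p) → lose (∈-allEdges e) p)
                  (Any.any? P? (allEdges _))

irr-dec : {A : Set} {P : .A → Set} → Dec A → (.(a : A) → Dec (P a)) →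
          Dec (.(a : A) → P a)
irr-dec (no ¬a) P? = yes λ a → ⊥-elim-irr (¬a a)
irr-dec (yes a) P? with P? a
... | yes p = yes λ _ → p
... | no ¬p = no λ f → ¬p (f a)

blocked? : (B : List (Edge n)) → Dec (Blocked B)
blocked? {n} B = map′ to from
  (Fin.all? λ a → Fin.all? λ b → Fin.all? λ c → Fin.all? λ d →
    irr-dec (a Fin.<? b) λ p → irr-dec (b Fin.<? c) λ q → irr-dec (c Fin.<? d) λ r →
    Any.any? (_∈? B) (edges (k₄ a b c d p q r)))
  where
  Blocked′ : Set
  Blocked′ = (a b c d : Fin n) .(p : a < b) .(q : b < c) .(r : c < d) →
             Any (_∈ B) (edges (k₄ a b c d p q r))

  to : Blocked′ → Blocked B
  to f (k₄ a b c d p q r) = f a b c d p q r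

  from : Blocked B → Blocked′
  from f a b c d p q r = f (k₄ a b c d p q r)

count : {A : Set} {P : A → Set} → Decidable P → List A → ℕ
count P? []       = 0
count P? (x ∷ xs) with P? x
... | yes _ = suc (count P? xs)
... | no  _ = count P? xs

module _ {A : Set} {P Q : A → Set} (P? : Decidable P) (Q? : Decidable Q)
         (P⊆Q : ∀ {x} → P x → Q x) where

  count-≤ : ∀ xs → count P? xs ℕ.≤ count Q? xs
  count-≤ [] = ℕ.z≤n
  count-≤ (x ∷ xs) with P? x | Q? x
  ... | yes _ | yes _ = ℕ.s≤s (count-≤ xs)
  ... | yes p | no ¬q = ⊥-elim (¬q (P⊆Q p))
  ... | no  _ | yes _ = ℕ.m≤n⇒m≤1+n (count-≤ xs)
  ... | no  _ | no  _ = count-≤ xs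

  count-< : ∀ {x xs} → x ∈ xs → ¬ P x → Q x → count P? xs ℕ.< count Q? xs
  count-< {xs = y ∷ ys} (here refl) ¬p q with P? y | Q? y
  ... | yes p | _     = ⊥-elim (¬p p)
  ... | no  _ | yes _ = ℕ.s≤s (count-≤ ys)
  ... | no  _ | no ¬q = ⊥-elim (¬q q)
  count-< {xs = y ∷ ys} (there x∈) ¬p q with P? y | Q? y
  ... | yes _ | yes _ = ℕ.s≤s (count-< x∈ ¬p q)
  ... | yes p | no ¬q = ⊥-elim (¬q (P⊆Q p))
  ... | no  _ | yes _ = ℕ.m≤n⇒m≤1+n (count-< x∈ ¬p q)
  ... | no  _ | no  _ = count-< x∈ ¬p q

#free : (M B : List (Edge n)) → ℕ
#free M B = count (free? M B) (allEdges _)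

#free-M : ∀ {M B : List (Edge n)} {e} → Free M B e → #free (e ∷ M) B ℕ.< #free M B
#free-M {e = e} fr = count-< (free? _ _) (free? _ _)
  (λ (p , q) → (λ z → p (there z)) , q) (∈-allEdges e) (λ (p , _) → p (here refl)) fr

#free-B : ∀ {M B : List (Edge n)} {e} → Free M B e → #free M (e ∷ B) ℕ.< #free M B
#free-B {e = e} fr = count-< (free? _ _) (free? _ _)
  (λ (p , q) → p , (λ z → q (there z))) (∈-allEdges e) (λ (_ , q) → q (here refl)) fr

guarded : {A : Set} {P : A → Set} → Dec A → ((a : A) → Dec (P a)) → (∀ a a′ → P a → P a′) →
          Dec (∀ a → P a)
guarded (no ¬a) P? irr = yes λ a → ⊥-elim (¬a a)
guarded (yes a) P? irr = map′ (λ p a′ → irr a a′ p) (λ f → f a) (P? a)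

mutual
  atMaker? : ∀ k q (M B : List (Edge n)) → #free M B ℕ.≤ k → Dec (AtMaker q M B)
  atMaker? k q M B le with blocked? B
  ... | yes bl = yes (blocked bl)
  ... | no ¬bl with any-dec (free? M B)
                  | all-dec (λ e → guarded (free? M B e) (afterMaker? k q M B le e) (λ _ _ w → w))
  ...   | yes ex | yes w = yes (reply ex w)
  ...   | no ¬ex | _     = no λ { (blocked bl) → ¬bl bl ; (reply ex _) → ¬ex ex }
  ...   | yes _  | no ¬w = no λ { (blocked bl) → ¬bl bl ; (reply _ w) → ¬w w }

  afterMaker? : ∀ k q (M B : List (Edge n)) → #free M B ℕ.≤ k → ∀ e → Free M B e →
                Dec (AtBreaker q (e ∷ M) B)
  afterMaker? zero    q M B le e fr = ⊥-elim (ℕ.n≮0 (ℕ.<-≤-trans (#free-M fr) le))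
  afterMaker? (suc k) q M B le e fr =
    atBreaker? k q (e ∷ M) B (ℕ.≤-pred (ℕ.<-≤-trans (#free-M fr) le))

  atBreaker? : ∀ k q (M B : List (Edge n)) → #free M B ℕ.≤ k → Dec (AtBreaker q M B)
  atBreaker? k q M B le
    with (length B ℕ.≤? q ℕ.* length M) ×-dec atMaker? k q M B le
       | any-dec (λ e → afterClaim? k q M B le e)
  ... | yes (bd , w) | _              = yes (endTurn bd w)
  ... | no _         | yes (e , fr , w) = yes (claim e fr w)
  ... | no ¬end      | no ¬cl         =
    no λ { (claim e fr w) → ¬cl (e , fr , w) ; (endTurn bd w) → ¬end (bd , w) }

  afterClaim? : ∀ k q (M B : List (Edge n)) → #free M B ℕ.≤ k → ∀ e →
                Dec (Free M B e × AtBreaker q M (e ∷ B))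
  afterClaim? k q M B le e with free? M B e
  ... | no ¬fr = no λ (fr , _) → ¬fr fr
  afterClaim? zero    q M B le e | yes fr = ⊥-elim (ℕ.n≮0 (ℕ.<-≤-trans (#free-B fr) le))
  afterClaim? (suc k) q M B le e | yes fr =
    map′ (fr ,_) proj₂ (atBreaker? k q M (e ∷ B) (ℕ.≤-pred (ℕ.<-≤-trans (#free-B fr) le)))

breakerWins? : (n q : ℕ) → Dec (BreakerWins n q)
breakerWins? n q = atMaker? _ q [] [] ℕ.≤-refl

sweep : ∀ q (M B xs : List (Edge n)) → length B ℕ.+ length xs ℕ.≤ q ℕ.* length M →
        (∀ B′ → (∀ {x} → x ∈ B → x ∈ B′) → (∀ {x} → x ∈ xs → x ∉ M → x ∈ B′) → Blocked B′) →
        AtBreaker q M B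
sweep q M B [] bd k =
  endTurn (subst (ℕ._≤ q ℕ.* length M) (ℕ.+-identityʳ (length B)) bd) (blocked (k B (λ z → z) λ ()))
sweep q M B (x ∷ xs) bd k with x ∈? M | x ∈? B
... | no x∉M | no x∉B = claim x (x∉M , x∉B)
  (sweep q M (x ∷ B) xs (subst (ℕ._≤ q ℕ.* length M) (ℕ.+-suc (length B) (length xs)) bd)
    λ B′ s t → k B′ (λ z → s (there z))
      λ { (here refl) _ → s (here refl) ; (there z) → t z })
... | yes x∈M | _ = sweep q M B xs
  (ℕ.≤-trans (ℕ.+-monoʳ-≤ (length B) (ℕ.n≤1+n _)) bd)
    λ B′ s t → k B′ s λ { (here refl) x∉M → ⊥-elim (x∉M x∈M) ; (there z) → t z }
... | no _ | yes x∈B = sweep q M B xs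
  (ℕ.≤-trans (ℕ.+-monoʳ-≤ (length B) (ℕ.n≤1+n _)) bd)
    λ B′ s t → k B′ s λ { (here refl) _ → s x∈B ; (there z) → t z }

blockedByRest : (e : Edge n) (B : List (Edge n)) → (∀ {x} → x ∉ (e ∷ []) → x ∈ B) → Blocked B
blockedByRest e B rest K@(k₄ a b c d p q r) with e ≟ᴱ edge a b p
... | no  e≢ab = here (rest λ { (here refl) → e≢ab refl })
... | yes refl = there (here (rest λ { (here refl) → ⊥-elim (absurd q) }))
  where
  absurd : ∀ {i : Fin n} → .(i < i) → ⊥
  absurd i<i = ⊥-elim-irr (ℕ.<-irrefl refl i<i)

someBias : (n : ℕ) → ∃ (BreakerWins n)
someBias n = length (allEdges n) , go (any-dec (free? [] []))
  where
  go : Dec (∃ (Free {n} [] [])) → BreakerWins n (length (allEdges n))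
  go (no ¬ex) = blocked λ { (k₄ a b _ _ a<b _ _) → ⊥-elim (¬ex (edge a b a<b , (λ ()) , λ ())) }
  go (yes ex) = reply ex λ e _ →
    sweep _ (e ∷ []) [] (allEdges n) (ℕ.≤-reflexive (sym (ℕ.*-identityʳ _)))
      λ B′ _ t → blockedByRest e B′ (t (∈-allEdges _))

IsLeast : (ℕ → Set) → ℕ → Set
IsLeast P q = P q × (∀ q′ → P q′ → q ℕ.≤ q′)

least : {P : ℕ → Set} → Decidable P → ∀ m → P m → ∃ (IsLeast P)
least P? m pm with P? 0
... | yes p0 = 0 , p0 , λ _ _ → ℕ.z≤n
least P? zero    pm | no ¬p0 = ⊥-elim (¬p0 pm)
least P? (suc m) pm | no ¬p0 with least (λ k → P? (suc k)) m pm
... | q , pq , min =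
  suc q , pq , λ { zero p → ⊥-elim (¬p0 p) ; (suc q′) p → ℕ.s≤s (min q′ p) }

leastBias : (n : ℕ) → ∃ (IsLeast (BreakerWins n))
leastBias n = let (q , w) = someBias n in least (breakerWins? n) q w

thresholdBias : ℕ → ℕ
thresholdBias n = proj₁ (leastBias n)

thresholdBias-isLeast : ∀ n → IsLeast (BreakerWins n) (thresholdBias n)
thresholdBias-isLeast n = proj₂ (leastBias n)

-- Non-negative real numbers, given by their (open) upper Dedekind cuts:
-- x <ᵁ r says that the rational r is strictly greater than x.

infix 4 _<ᵁ_

record ℝ≥0 : Set₁ where
  field
    upper     : ℚ → Set
    inhabited : ∃ upper
    positive  : ∀ {r} → upper r → 0ℚ ℚ.< r
    upward    : ∀ {r s} → upper r → r ℚ.≤ s → upper s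
    rounded   : ∀ {r} → upper r → ∃[ s ] upper s × s ℚ.< r

open ℝ≥0 public

_<ᵁ_ : ℝ≥0 → ℚ → Set
x <ᵁ r = upper x r

infix 4 _≤ᴿ_

_≤ᴿ_ : ℝ≥0 → ℝ≥0 → Set
x ≤ᴿ y = ∀ r → y <ᵁ r → x <ᵁ r

p<p+1 : ∀ p → p ℚ.< p ℚ.+ 1ℚ
p<p+1 p = subst (ℚ._< p ℚ.+ 1ℚ) (ℚ.+-identityʳ p) (ℚ.+-monoʳ-< p (ℚ.positive⁻¹ 1ℚ))

*-mono-<ˡ : ∀ {s s′ t} → s′ ℚ.< s → 0ℚ ℚ.< t → s′ ℚ.* t ℚ.< s ℚ.* t
*-mono-<ˡ {t = t} s′<s 0<t = ℚ.*-monoˡ-<-pos t {{ℚ.positive 0<t}} s′<s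

*-pos : ∀ {s t} → 0ℚ ℚ.< s → 0ℚ ℚ.< t → 0ℚ ℚ.< s ℚ.* t
*-pos {s} {t} 0<s 0<t = subst (ℚ._< s ℚ.* t) (ℚ.*-zeroˡ t) (*-mono-<ˡ 0<s 0<t)

^-nonNeg : ∀ {s} a → 0ℚ ℚ.< s → 0ℚ ℚ.≤ s ^ a
^-nonNeg zero    0<s = ℚ.<⇒≤ (ℚ.positive⁻¹ 1ℚ)
^-nonNeg {s} (suc a) 0<s = subst (ℚ._≤ s ^ suc a) (ℚ.*-zeroʳ s)
  (ℚ.*-monoˡ-≤-nonNeg s {{ℚ.nonNegative (ℚ.<⇒≤ 0<s)}} (^-nonNeg a 0<s))

1≤^ : ∀ {t} b → 1ℚ ℚ.≤ t → 1ℚ ℚ.≤ t ^ b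
t≤^ : ∀ {t} b .{{_ : NonZero b}} → 1ℚ ℚ.≤ t → t ℚ.≤ t ^ b
1≤^ zero    1≤t = ℚ.≤-refl
1≤^ (suc b) 1≤t = ℚ.≤-trans 1≤t (t≤^ (suc b) 1≤t)
t≤^ {t} (suc b) 1≤t = subst (ℚ._≤ t ^ suc b) (ℚ.*-identityʳ t)
  (ℚ.*-monoˡ-≤-nonNeg t {{ℚ.nonNegative (ℚ.≤-trans (ℚ.<⇒≤ (ℚ.positive⁻¹ 1ℚ)) 1≤t)}} (1≤^ b 1≤t))

fromℚ : (p : ℚ) .{{_ : NonNegative p}} → ℝ≥0
fromℚ p = record
  { upper     = p ℚ.<_
  ; inhabited = p ℚ.+ 1ℚ , p<p+1 p
  ; positive  = ℚ.≤-<-trans (ℚ.nonNegative⁻¹ p)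
  ; upward    = ℚ.<-≤-trans
  ; rounded   = λ p<r → let (s , p<s , s<r) = ℚ.<-dense p<r in s , p<s , s<r
  }

fromℕ : ℕ → ℝ≥0
fromℕ m = fromℚ (+ m / 1) {{ℚ.normalize-nonNeg m 1}}

infixl 6 _+ᴿ_
infixl 7 _*ᴿ_
infix  8 _^[_/_]

_+ᴿ_ : ℝ≥0 → ℝ≥0 → ℝ≥0
x +ᴿ y = record
  { upper     = λ r → ∃[ s ] ∃[ t ] x <ᵁ s × y <ᵁ t × s ℚ.+ t ℚ.≤ r
  ; inhabited = let (s , xs) = inhabited x ; (t , yt) = inhabited y in
                s ℚ.+ t , s , t , xs , yt , ℚ.≤-refl
  ; positive  = λ (s , t , xs , yt , le) →
                ℚ.<-≤-trans (ℚ.+-mono-< (positive x xs) (positive y yt)) le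
  ; upward    = λ (s , t , xs , yt , le) r≤r′ → s , t , xs , yt , ℚ.≤-trans le r≤r′
  ; rounded   = λ (s , t , xs , yt , le) → let (s′ , xs′ , s′<s) = rounded x xs in
                s′ ℚ.+ t , (s′ , t , xs′ , yt , ℚ.≤-refl) ,
                ℚ.<-≤-trans (ℚ.+-monoˡ-< t s′<s) le
  }

_*ᴿ_ : ℝ≥0 → ℝ≥0 → ℝ≥0
x *ᴿ y = record
  { upper     = λ r → ∃[ s ] ∃[ t ] x <ᵁ s × y <ᵁ t × s ℚ.* t ℚ.≤ r
  ; inhabited = let (s , xs) = inhabited x ; (t , yt) = inhabited y in
                s ℚ.* t , s , t , xs , yt , ℚ.≤-refl
  ; positive  = λ (s , t , xs , yt , le) →
                ℚ.<-≤-trans (*-pos (positive x xs) (positive y yt)) le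
  ; upward    = λ (s , t , xs , yt , le) r≤r′ → s , t , xs , yt , ℚ.≤-trans le r≤r′
  ; rounded   = λ (s , t , xs , yt , le) → let (s′ , xs′ , s′<s) = rounded x xs in
                s′ ℚ.* t , (s′ , t , xs′ , yt , ℚ.≤-refl) ,
                ℚ.<-≤-trans (*-mono-<ˡ s′<s (positive y yt)) le
  }

-- x ^[ a / b ] is the real power with exponent a/b: its upper cut consists of
-- the r exceeding some t > 0 with sᵃ ≤ tᵇ for some rational s > x.
_^[_/_] : ℝ≥0 → (a b : ℕ) .{{_ : NonZero b}} → ℝ≥0
x ^[ a / b ] = record
  { upper     = λ r → ∃[ s ] ∃[ t ] x <ᵁ s × 0ℚ ℚ.< t × s ^ a ℚ.≤ t ^ b × t ℚ.< r
  ; inhabited = let (s , xs) = inhabited x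
                    t        = s ^ a ℚ.+ 1ℚ
                    0≤sᵃ     = ^-nonNeg a (positive x xs)
                    1≤t      = ℚ.+-monoˡ-≤ 1ℚ 0≤sᵃ
                in t ℚ.+ 1ℚ , s , t , xs , ℚ.<-≤-trans (ℚ.positive⁻¹ 1ℚ) 1≤t ,
                   ℚ.≤-trans (ℚ.<⇒≤ (p<p+1 (s ^ a))) (t≤^ b 1≤t) , p<p+1 t
  ; positive  = λ (s , t , xs , 0<t , le , t<r) → ℚ.<-trans 0<t t<r
  ; upward    = λ (s , t , xs , 0<t , le , t<r) r≤r′ →
                s , t , xs , 0<t , le , ℚ.<-≤-trans t<r r≤r′
  ; rounded   = λ (s , t , xs , 0<t , le , t<r) → let (m , t<m , m<r) = ℚ.<-dense t<r in
                m , (s , t , xs , 0<t , le , t<m) , m<r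
  }

sup : (f : ℕ → ℚ) → 0ℚ ℚ.≤ f 0 → ∃[ p ] (∀ k → f k ℚ.≤ p) → ℝ≥0
sup f 0≤f0 (p , f≤p) = record
  { upper     = λ r → ∃[ s ] (∀ k → f k ℚ.≤ s) × s ℚ.< r
  ; inhabited = p ℚ.+ 1ℚ , p , f≤p , p<p+1 p
  ; positive  = λ (s , f≤s , s<r) → ℚ.≤-<-trans (ℚ.≤-trans 0≤f0 (f≤s 0)) s<r
  ; upward    = λ (s , f≤s , s<r) r≤r′ → s , f≤s , ℚ.<-≤-trans s<r r≤r′
  ; rounded   = λ (s , f≤s , s<r) → let (m , s<m , m<r) = ℚ.<-dense s<r in
                m , (s , f≤s , s<m) , m<r
  }

invFact : ℕ → ℚ
invFact k = _/_ (+ 1) (k !) {{ℕ._!≢0 k}}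

-- expSum k = 1/0! + 1/1! + ⋯ + 1/k!
expSum : ℕ → ℚ
expSum zero    = invFact 0
expSum (suc k) = expSum k ℚ.+ invFact (suc k)

ℚᵘ-fact : ∀ k → ℚ.toℚᵘ (invFact k) ℚᵘ.≃ ℚᵘ._/_ (+ 1) (k !) {{ℕ._!≢0 k}}
ℚᵘ-fact k = go (k !) {{ℕ._!≢0 k}}
  where
  go : ∀ m .{{_ : NonZero m}} → ℚ.toℚᵘ (+ 1 / m) ℚᵘ.≃ (+ 1) ℚᵘ./ m
  go (suc m) = ℚ.toℚᵘ-fromℚᵘ (mkℚᵘ (+ 1) m)

double : ∀ k → invFact (suc (suc k)) ℚ.+ invFact (suc (suc k)) ℚ.≤ invFact (suc k)
double k = ℚ.toℚᵘ-cancel-≤ (ℚᵘ.≤-trans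
  (ℚᵘ.≤-reflexive (ℚᵘ.≃-trans (ℚ.toℚᵘ-homo-+ (invFact (suc (suc k))) (invFact (suc (suc k))))
                              (ℚᵘ.+-cong (ℚᵘ-fact (suc (suc k))) (ℚᵘ-fact (suc (suc k))))))
  (ℚᵘ.≤-trans (go (suc k !) (suc (suc k) !) {{ℕ._!≢0 (suc k)}} {{ℕ._!≢0 (suc (suc k))}} 2b≤a)
              (ℚᵘ.≤-reflexive (ℚᵘ.≃-sym (ℚᵘ-fact (suc k))))))
  where
  2b≤a : 2 ℕ.* (suc k !) ℕ.≤ suc (suc k) !
  2b≤a = ℕ.*-monoˡ-≤ (suc k !) (ℕ.s≤s (ℕ.s≤s (ℕ.z≤n {k})))

  go : ∀ b a .{{_ : NonZero b}} .{{_ : NonZero a}} → 2 ℕ.* b ℕ.≤ a →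
       (+ 1) ℚᵘ./ a ℚᵘ.+ (+ 1) ℚᵘ./ a ℚᵘ.≤ (+ 1) ℚᵘ./ b
  go b@(suc _) a@(suc _) 2b≤a = ℚᵘ.*≤* (ℤ.+≤+ (begin
    (1 ℕ.* a ℕ.+ 1 ℕ.* a) ℕ.* b ≡⟨ cong (λ z → (z ℕ.+ z) ℕ.* b) (ℕ.*-identityˡ a) ⟩
    (a ℕ.+ a) ℕ.* b             ≡⟨ cong (λ z → (a ℕ.+ z) ℕ.* b) (sym (ℕ.+-identityʳ a)) ⟩
    (2 ℕ.* a) ℕ.* b             ≡⟨ cong (ℕ._* b) (ℕ.*-comm 2 a) ⟩
    (a ℕ.* 2) ℕ.* b             ≡⟨ ℕ.*-assoc a 2 b ⟩
    a ℕ.* (2 ℕ.* b)             ≤⟨ ℕ.*-monoʳ-≤ a 2b≤a ⟩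
    a ℕ.* a                     ≡⟨ sym (ℕ.*-identityˡ _) ⟩
    1 ℕ.* (a ℕ.* a)             ∎))
    where open ℕ.≤-Reasoning

3ℚ : ℚ
3ℚ = + 3 / 1

0≤invFact : ∀ k → 0ℚ ℚ.≤ invFact k
0≤invFact k = ℚ.nonNegative⁻¹ (invFact k) {{ℚ.normalize-nonNeg 1 (k !) {{ℕ._!≢0 k}}}}

expSum+≤3 : ∀ k → expSum (suc k) ℚ.+ invFact (suc k) ℚ.≤ 3ℚ
expSum+≤3 zero    = ℚ.≤-refl
expSum+≤3 (suc k) = begin
  (expSum (suc k) ℚ.+ invFact (suc (suc k))) ℚ.+ invFact (suc (suc k))
    ≡⟨ ℚ.+-assoc (expSum (suc k)) _ _ ⟩
  expSum (suc k) ℚ.+ (invFact (suc (suc k)) ℚ.+ invFact (suc (suc k)))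
    ≤⟨ ℚ.+-monoʳ-≤ (expSum (suc k)) (double k) ⟩
  expSum (suc k) ℚ.+ invFact (suc k)
    ≤⟨ expSum+≤3 k ⟩
  3ℚ ∎
  where open ℚ.≤-Reasoning

p≤p+q : ∀ p {q} → 0ℚ ℚ.≤ q → p ℚ.≤ p ℚ.+ q
p≤p+q p {q} 0≤q = subst (ℚ._≤ p ℚ.+ q) (ℚ.+-identityʳ p) (ℚ.+-monoʳ-≤ p 0≤q)

expSum≤3 : ∀ k → expSum k ℚ.≤ 3ℚ
expSum≤3 k = ℚ.≤-trans (p≤p+q (expSum k) (0≤invFact (suc k)))
  (ℚ.≤-trans (p≤p+q (expSum (suc k)) (0≤invFact (suc k))) (expSum+≤3 k))

euler : ℝ≥0
euler = sup expSum (0≤invFact 0) (3ℚ , expSum≤3)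

-- 5 · 2^(-9/5) · e^(2/5); the factor 2^(-9/5) is written as (1/2)^(9/5).
C : ℝ≥0
C = fromℕ 5 *ᴿ fromℚ ½ ^[ 9 / 5 ] *ᴿ euler ^[ 2 / 5 ]

{-# OPTIONS --safe #-}

-- With n between (2r)⁵ and (2r+2)⁵, Breaker wins with bias 8r² = 6r² + 2r².  He
-- answers every copy of K₄ minus an edge in Maker's graph M by claiming the
-- missing edge, and plays p = 6r² further edges per turn greedily, so as to keep
-- the codegree of every pair of vertices in M at most t = 2r.  A copy of K₄ minus
-- an edge is a pair of triangles on a common edge, so there are at most
-- |M| C(t,2) ≤ 2r² |M| of them; in the budget game only this total matters, not
-- the number of copies that a single Maker move creates.
--
-- The greedy claims follow Beck's criterion for the potential
-- Σ_{i<j} Π_w (D + x_{iw} x_{jw}), where D = p² and x is 1 + p on Maker's edges,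
-- 0 on Breaker's edges and 1 on free edges.  It is at most n² (D+1)ⁿ at the start
-- and never exceeds (1+p) n² (D+1)ⁿ, whereas a codegree c forces it to be at least
-- Dⁿ 2ᶜ.  This Chernoff-type product, used in place of a sum over the t-subsets of
-- the common neighbours, makes t p² = 72 r⁵ ≥ 2n sufficient where a union bound
-- needs t p² > e n.  Hence 8r² ≤ 2 n^(2/5), and 2 < 5 · 2^(-9/5) · e^(2/5).

module Submission where

open import Defs
open import Data.Nat.Base using (ℕ; _≤_)
open import Data.Product.Base using (∃-syntax)
open import Data.Rational.Base using (ℚ; Positive)
open import Data.Rational.Properties using (pos⇒nonNeg)
open import Algebra.Bundles using (CommutativeRing)
open import Data.Empty using (⊥-elim; ⊥-elim-irr)
open import Data.Fin.Base as Fin using (Fin)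
import Data.Fin.Properties as Fin
import Data.Integer.Base as ℤ
import Data.Integer.Properties as ℤ
open import Data.List.Base using (List; []; _∷_; _++_; length; map; concatMap; filter; allFin)
open import Data.List.Extrema.Nat using (argmax; argmax-all; f[xs]≤f[argmax])
open import Data.List.Membership.Propositional using (_∈_; _∉_; find; lose)
open import Data.List.Membership.Propositional.Properties
  using (∈-++⁺ˡ; ∈-++⁺ʳ; ∈-++⁻; ∈-∃++; ∈-map⁺; ∈-map⁻; ∈-allFin; ∈-filter⁺; ∈-filter⁻;
         ∈-concatMap⁺; ∈-concatMap⁻)
open import Data.List.Properties using (length-tabulate; length-++; length-map)
open import Data.List.Relation.Binary.Subset.Propositional using (_⊆_)
open import Data.List.Relation.Unary.All as All using (All; []; _∷_)
open import Data.List.Relation.Unary.All.Properties using (all-filter; ¬All⇒Any¬)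
open import Data.List.Relation.Unary.AllPairs using ([]; _∷_)
open import Data.List.Relation.Unary.Any as Any using (Any; here; there)
open import Data.List.Relation.Unary.Unique.Propositional using (Unique)
open import Data.List.Relation.Unary.Unique.Propositional.Properties using (allFin⁺)
open import Data.Nat.Base
  using (zero; suc; _+_; _*_; _∸_; _^_; _<_; z≤n; s≤s; z<s; NonZero; >-nonZero; >-nonZero⁻¹)
open import Data.Nat.Properties
open import Data.Nat.Tactic.RingSolver using (solve-∀)
open import Data.Product.Base using (_×_; _,_; proj₁; proj₂; uncurry)
open import Data.Rational.Base as ℚ using (0ℚ; 1ℚ; ½)
import Data.Rational.Properties as ℚ
import Data.Rational.Unnormalised.Base as ℚᵘ
import Data.Rational.Unnormalised.Properties as ℚᵘ
open import Algebra.Definitions.RawSemiring ℚ.+-*-rawSemiring using () renaming (_^_ to _^ℚ_)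
open import Algebra.Properties.CommutativeSemiring.Exp
  (CommutativeRing.commutativeSemiring ℚ.+-*-commutativeRing) using (^-distrib-*)
open import Data.Sum.Base using (_⊎_; inj₁; inj₂; [_,_]′)
open import Function.Base using (_∘_; id)
open import Relation.Binary.Construct.Closure.ReflexiveTransitive
  using (Star; _◅_; _◅◅_) renaming (ε to pass)
open import Relation.Binary.PropositionalEquality
  using (_≡_; _≢_; refl; sym; trans; cong; cong₂; subst; subst₂; ≢-sym; module ≡-Reasoning)
open import Relation.Nullary using (Dec; yes; no; ¬_)
open import Relation.Nullary.Decidable using (_×-dec_; from-yes)
open import Relation.Unary using (Decidable)

private variable
  n : ℕ
  A : Set

open Edge

-- Multi-affine potentials

Valuation : ℕ → Set
Valuation n = Edge n → ℕ

-- A polynomial with non-negative coefficients in the variables v e, of degree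
-- at most one in each of them.  The law affine says that changing the variable
-- at e from 1 to x adds (x − 1) ∂ e v.
record MultiAffine (n : ℕ) : Set where
  field
    eval      : Valuation n → ℕ
    ∂         : Edge n → Valuation n → ℕ
    eval-mono : ∀ {v w} → (∀ e → v e ≤ w e) → eval v ≤ eval w
    ∂-mono    : ∀ e {v w} → (∀ f → v f ≤ w f) → ∂ e v ≤ ∂ e w
    affine    : ∀ e {v w} → v e ≡ 1 → (∀ {f} → f ≢ e → w f ≡ v f) →
                eval w + ∂ e v ≡ eval v + w e * ∂ e v

open MultiAffine

const : ℕ → MultiAffine n
const c = record
  { eval      = λ _ → c
  ; ∂         = λ _ _ → 0
  ; eval-mono = λ _ → ≤-refl
  ; ∂-mono    = λ _ _ → ≤-refl
  ; affine    = λ e {_} {w} _ _ → cong (c +_) (sym (*-zeroʳ (w e)))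
  }

indicator : {A : Set} → Dec A → ℕ
indicator (yes _) = 1
indicator (no _)  = 0

var : Edge n → MultiAffine n
var f = record
  { eval      = λ v → v f
  ; ∂         = λ e _ → indicator (e ≟ᴱ f)
  ; eval-mono = λ v≤w → v≤w f
  ; ∂-mono    = λ _ _ → ≤-refl
  ; affine    = affine′
  }
  where
  affine′ : ∀ e {v w : Valuation _} → v e ≡ 1 → (∀ {f} → f ≢ e → w f ≡ v f) →
            w f + indicator (e ≟ᴱ f) ≡ v f + w e * indicator (e ≟ᴱ f)
  affine′ e {v} {w} ve≡1 w≡v with e ≟ᴱ f
  ... | yes refl = trans (+-comm (w f) 1) (cong₂ _+_ (sym ve≡1) (sym (*-identityʳ (w f))))
  ... | no  e≢f  = cong₂ _+_ (w≡v (e≢f ∘ sym)) (sym (*-zeroʳ (w e)))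

infixl 6 _⊕_

_⊕_ : MultiAffine n → MultiAffine n → MultiAffine n
P ⊕ Q = record
  { eval      = λ v → eval P v + eval Q v
  ; ∂         = λ e v → ∂ P e v + ∂ Q e v
  ; eval-mono = λ v≤w → +-mono-≤ (eval-mono P v≤w) (eval-mono Q v≤w)
  ; ∂-mono    = λ e v≤w → +-mono-≤ (∂-mono P e v≤w) (∂-mono Q e v≤w)
  ; affine    = λ e {v} {w} ve≡1 w≡v →
      trans (interchange (eval P w) (eval Q w) (∂ P e v) (∂ Q e v))
     (trans (cong₂ _+_ (affine P e ve≡1 w≡v) (affine Q e ve≡1 w≡v))
            (collect (eval P v) (eval Q v) (∂ P e v) (∂ Q e v) (w e)))
  }
  where
  interchange : ∀ a b c d → (a + b) + (c + d) ≡ (a + c) + (b + d)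
  interchange = solve-∀

  collect : ∀ a b c d x → (a + x * c) + (b + x * d) ≡ (a + b) + x * (c + d)
  collect = solve-∀

⨁ : List A → (A → MultiAffine n) → MultiAffine n
⨁ []       P = const 0
⨁ (x ∷ xs) P = P x ⊕ ⨁ xs P

Disjoint : MultiAffine n → MultiAffine n → Set
Disjoint P Q = ∀ e v → ∂ P e v ≡ 0 ⊎ ∂ Q e v ≡ 0

-- A factor whose derivative at `e` vanishes does not change with the variable at `e`, so the
-- product rule is exact and no quadratic term arises.
product : (P Q : MultiAffine n) → Disjoint P Q → MultiAffine n
product P Q disjoint = record
  { eval      = λ v → eval P v * eval Q v
  ; ∂         = λ e v → ∂ P e v * eval Q v + eval P v * ∂ Q e v
  ; eval-mono = λ v≤w → *-mono-≤ (eval-mono P v≤w) (eval-mono Q v≤w)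
  ; ∂-mono    = λ e v≤w → +-mono-≤ (*-mono-≤ (∂-mono P e v≤w) (eval-mono Q v≤w))
                                   (*-mono-≤ (eval-mono P v≤w) (∂-mono Q e v≤w))
  ; affine    = λ e {v} {w} ve≡1 w≡v →
      leibniz (w e) (disjoint e v) (affine P e ve≡1 w≡v) (affine Q e ve≡1 w≡v)
  }
  where
  leibniz : ∀ {p p′ q q′ ∂p ∂q} x → ∂p ≡ 0 ⊎ ∂q ≡ 0 →
            p′ + ∂p ≡ p + x * ∂p → q′ + ∂q ≡ q + x * ∂q →
            p′ * q′ + (∂p * q + p * ∂q) ≡ p * q + x * (∂p * q + p * ∂q)
  leibniz {p} {p′} {q} {q′} {_} {∂q} x (inj₁ refl) hp hq
    with refl ← trans (sym (+-identityʳ p′)) (trans hp (trans (cong (p +_) (*-zeroʳ x)) (+-identityʳ p)))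
    = trans (sym (*-distribˡ-+ p q′ ∂q)) (trans (cong (p *_) hq) (expand p q x ∂q))
    where
    expand : ∀ p q x d → p * (q + x * d) ≡ p * q + x * (p * d)
    expand = solve-∀
  leibniz {p} {p′} {q} {q′} {∂p} {_} x (inj₂ refl) hp hq
    with refl ← trans (sym (+-identityʳ q′)) (trans hq (trans (cong (q +_) (*-zeroʳ x)) (+-identityʳ q)))
    = trans (collect p′ p q ∂p) (trans (cong (_* q) hp) (expand p q x ∂p))
    where
    collect : ∀ p′ p q d → p′ * q + (d * q + p * 0) ≡ (p′ + d) * q
    collect = solve-∀

    expand : ∀ p q x d → (p + x * d) * q ≡ p * q + x * (d * q + p * 0)
    expand = solve-∀

-- The variable e may occur only in the factor indexed by pivot e.
⨂ : (xs : List A) → Unique xs → (P : A → MultiAffine n) (pivot : Edge n → A) →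
    (∀ e v {x} → x ≢ pivot e → ∂ (P x) e v ≡ 0) → MultiAffine n
∂-⨂ : ∀ (xs : List A) uniq (P : A → MultiAffine n) pivot away e v →
       All (_≢ pivot e) xs → ∂ (⨂ xs uniq P pivot away) e v ≡ 0

⨂ []       _             P pivot away = const 1
⨂ {n = n} (x ∷ xs) (x∉xs ∷ uniq) P pivot away = product (P x) rest disjoint
  where
  rest : MultiAffine n
  rest = ⨂ xs uniq P pivot away

  disjoint : Disjoint (P x) rest
  disjoint e v with ∂ (P x) e v in eq
  ... | zero  = inj₁ refl
  -- A non-zero derivative makes `x` the pivot of `e`, and as the indices are distinct, the pivot
  -- does not recur in `xs`.
  ... | suc _ = inj₂ (∂-⨂ xs uniq P pivot away e v
    (All.map (λ x≢y y≡π → 0≢1+n (trans (sym (away e v λ x≡π → x≢y (trans x≡π (sym y≡π)))) eq)) x∉xs))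

∂-⨂ []       _          P pivot away e v _           = refl
∂-⨂ (x ∷ xs) (_ ∷ uniq) P pivot away e v (x≢π ∷ xs≢π) = cong₂ _+_
  (cong (_* eval (⨂ xs uniq P pivot away) v) (away e v x≢π))
  (trans (cong (eval (P x) v *_) (∂-⨂ xs uniq P pivot away e v xs≢π)) (*-zeroʳ (eval (P x) v)))

-- Setting the variable at `e` to 0 lowers the value by exactly `∂ P e v`, and the result is still a
-- natural number.
∂≤eval : (P : MultiAffine n) → ∀ e {v} → v e ≡ 1 → ∂ P e v ≤ eval P v
∂≤eval {n} P e {v} ve≡1 = begin
  ∂ P e v                    ≤⟨ m≤n+m _ _ ⟩
  eval P erased + ∂ P e v    ≡⟨ affine P e ve≡1 erased-else ⟩
  eval P v + erased e * ∂ P e v ≡⟨ cong (λ x → eval P v + x * ∂ P e v) erased-at ⟩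
  eval P v + 0               ≡⟨ +-identityʳ _ ⟩
  eval P v                   ∎
  where
  open ≤-Reasoning
  erased : Valuation n
  erased f with f ≟ᴱ e
  ... | yes _ = 0
  ... | no  _ = v f

  erased-at : erased e ≡ 0
  erased-at with e ≟ᴱ e
  ... | yes _ = refl
  ... | no ¬p = ⊥-elim (¬p refl)

  erased-else : ∀ {f} → f ≢ e → erased f ≡ v f
  erased-else {f} f≢e with f ≟ᴱ e
  ... | yes f≡e = ⊥-elim (f≢e f≡e)
  ... | no  _   = refl

eval-⨁-∈ : ∀ {xs : List A} (P : A → MultiAffine n) v {x} → x ∈ xs →
           eval (P x) v ≤ eval (⨁ xs P) v
eval-⨁-∈ P v (here refl) = m≤m+n _ _
eval-⨁-∈ P v (there x∈)  = ≤-trans (eval-⨁-∈ P v x∈) (m≤n+m _ _)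

eval-⨁-≤ : ∀ (xs : List A) (P : A → MultiAffine n) v {b} → (∀ x → eval (P x) v ≤ b) →
           eval (⨁ xs P) v ≤ length xs * b
eval-⨁-≤ []       P v ≤b = z≤n
eval-⨁-≤ (x ∷ xs) P v ≤b = +-mono-≤ (≤b x) (eval-⨁-≤ xs P v ≤b)

∂-⨁ : ∀ (xs : List A) (P : A → MultiAffine n) e v → (∀ {x} → x ∈ xs → ∂ (P x) e v ≡ 0) →
      ∂ (⨁ xs P) e v ≡ 0
∂-⨁ []       P e v zeros = refl
∂-⨁ (x ∷ xs) P e v zeros = cong₂ _+_ (zeros (here refl)) (∂-⨁ xs P e v (zeros ∘ there))

eval-⨂-≤ : ∀ (xs : List A) uniq (P : A → MultiAffine n) pivot away v {b} →
           (∀ x → eval (P x) v ≤ b) → eval (⨂ xs uniq P pivot away) v ≤ b ^ length xs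
eval-⨂-≤ []       _          P pivot away v ≤b = ≤-refl
eval-⨂-≤ (x ∷ xs) (_ ∷ uniq) P pivot away v ≤b =
  *-mono-≤ (≤b x) (eval-⨂-≤ xs uniq P pivot away v ≤b)

-- Turns a number of indices into a power of 2: with the common neighbours of a pair as `R`, a large
-- codegree makes the product exponentially large.
eval-⨂-≥ : ∀ (xs : List A) uniq (P : A → MultiAffine n) pivot away v {b} {R : A → Set}
           (R? : Decidable R) → (∀ x → b ≤ eval (P x) v) → (∀ {x} → R x → b + b ≤ eval (P x) v) →
           b ^ length xs * 2 ^ length (filter R? xs) ≤ eval (⨂ xs uniq P pivot away) v
eval-⨂-≥ []       _          P pivot away v R? ≥b ≥2b = ≤-refl
eval-⨂-≥ (x ∷ xs) (_ ∷ uniq) P pivot away v {b} R? ≥b ≥2b with R? x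
... | yes r = ≤-trans (≤-reflexive (regroup (b ^ length xs) b (2 ^ length (filter R? xs))))
                      (*-mono-≤ (≥2b r) (eval-⨂-≥ xs uniq P pivot away v R? ≥b ≥2b))
  where
  regroup : ∀ x b y → (b * x) * (2 * y) ≡ (b + b) * (x * y)
  regroup = solve-∀
... | no  _ = ≤-trans (≤-reflexive (*-assoc b (b ^ length xs) _))
                      (*-mono-≤ (≥b x) (eval-⨂-≥ xs uniq P pivot away v R? ≥b ≥2b))

-- The codegree potential

-- At most one edge, because edgesBetween i j is empty unless i < j.
link : (i j : Fin n) → List (Edge n)
link i j = edgesBetween i j ++ edgesBetween j i

edgesBetween-∈ : ∀ (i j : Fin n) {e} → e ∈ edgesBetween i j → src e ≡ i × tgt e ≡ j
edgesBetween-∈ i j e∈ with i Fin.<? j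
edgesBetween-∈ i j (here refl) | yes _ = refl , refl

∈-link⁻ : ∀ (i j : Fin n) {e} → e ∈ link i j → (src e ≡ i × tgt e ≡ j) ⊎ (src e ≡ j × tgt e ≡ i)
∈-link⁻ i j e∈ with ∈-++⁻ (edgesBetween i j) e∈
... | inj₁ e∈₁ = inj₁ (edgesBetween-∈ i j e∈₁)
... | inj₂ e∈₂ = inj₂ (edgesBetween-∈ j i e∈₂)

∈-link⁺ : ∀ (i j : Fin n) .(i<j : i Fin.< j) → edge i j i<j ∈ link i j × edge i j i<j ∈ link j i
∈-link⁺ i j i<j = ∈-++⁺ˡ (∈-edgesBetween i j i<j) , ∈-++⁺ʳ (edgesBetween j i) (∈-edgesBetween i j i<j)

link-refl : (i : Fin n) → link i i ≡ []
link-refl i with i Fin.<? i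
... | yes i<i = ⊥-elim (<-irrefl refl i<i)
... | no  _   = refl

length-edgesBetween : (i j : Fin n) → length (edgesBetween i j) ≤ 1
length-edgesBetween i j with i Fin.<? j
... | yes _ = ≤-refl
... | no  _ = z≤n

length-link : (i j : Fin n) → length (link i j) ≤ 1
length-link i j with i Fin.<? j | j Fin.<? i
... | yes i<j | yes j<i = ⊥-elim (<-asym i<j j<i)
... | yes _   | no  _   = ≤-refl
... | no  _   | yes _   = ≤-refl
... | no  _   | no  _   = z≤n

loopless : (e : Edge n) → src e ≢ tgt e
loopless (edge i .i i<i) refl = ⊥-elim-irr (<-irrefl refl i<i)

-- If the endpoints were matched crosswise, `e` would be a loop. Hence the links from two distinct
-- vertices to `k` share no variable, as `product` requires.
link-injective : ∀ (i j k : Fin n) {e} → e ∈ link i k → e ∈ link j k → i ≡ j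
link-injective i j k {e} e∈ik e∈jk with ∈-link⁻ i k e∈ik | ∈-link⁻ j k e∈jk
... | inj₁ (refl , _)    | inj₁ (refl , _)    = refl
... | inj₁ (refl , refl) | inj₂ (p , _)       = ⊥-elim (loopless e p)
... | inj₂ (refl , refl) | inj₁ (_ , p)       = ⊥-elim (loopless e (sym p))
... | inj₂ (_ , refl)    | inj₂ (_ , refl)    = refl

linkSum : (i j : Fin n) → MultiAffine n
linkSum i j = ⨁ (link i j) var

∂-linkSum : ∀ (i j : Fin n) e v → e ∉ link i j → ∂ (linkSum i j) e v ≡ 0
∂-linkSum i j e v e∉ = ∂-⨁ (link i j) var e v λ {f} f∈ → away f f∈
  where
  away : ∀ f → f ∈ link i j → indicator (e ≟ᴱ f) ≡ 0
  away f f∈ with e ≟ᴱ f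
  ... | yes refl = ⊥-elim (e∉ f∈)
  ... | no  _    = refl

eval-linkSum-≤1 : ∀ (i j : Fin n) {v} → (∀ e → v e ≤ 1) → eval (linkSum i j) v ≤ 1
eval-linkSum-≤1 i j {v} v≤1 = ≤-trans (eval-⨁-≤ (link i j) var v v≤1)
  (≤-trans (≤-reflexive (*-identityʳ _)) (length-link i j))

disjointLinks : ∀ (i j w : Fin n) → i ≢ j → Disjoint (linkSum i w) (linkSum j w)
disjointLinks i j w i≢j e v with e ∈? link i w
... | no  e∉  = inj₁ (∂-linkSum i w e v e∉)
... | yes e∈i = inj₂ (∂-linkSum j w e v λ e∈j → i≢j (link-injective i j w e∈i e∈j))

-- At an endpoint w of g this is the constant D, because link w w is empty.
pairFactor : (D : ℕ) (g : Edge n) (w : Fin n) → MultiAffine n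
pairFactor D g w = const D ⊕ product (linkSum (src g) w) (linkSum (tgt g) w)
                                     (disjointLinks (src g) (tgt g) w (loopless g))

-- For an edge `e` meeting `g` in one vertex this is the other end of `e`, the only `w` whose factor
-- contains `e`. An edge equal to or disjoint from `g` occurs in no factor, and any vertex will do.
pivot : (g e : Edge n) → Fin n
pivot g e with src e Fin.≟ src g | src e Fin.≟ tgt g
... | no _ | no _ = src e
... | _    | _    = tgt e

∂-pairFactor : ∀ D (g e : Edge n) v {w} → w ≢ pivot g e → ∂ (pairFactor D g w) e v ≡ 0
∂-pairFactor D g e v {w} w≢π with w Fin.≟ src g | w Fin.≟ tgt g
... | yes refl | _ rewrite link-refl w = refl
... | no _ | yes refl rewrite link-refl w =
  cong₂ _+_ (*-zeroʳ (∂ (linkSum (src g) w) e v)) (*-zeroʳ (eval (linkSum (src g) w) v))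
... | no w≢s | no w≢t = cong₂ _+_
  (cong (_* eval (linkSum (tgt g) w) v) (∂-linkSum (src g) w e v (w≢π ∘ [ viaˢ , to ]′ ∘ ∈-link⁻ _ w)))
  (trans (cong (eval (linkSum (src g) w) v *_)
               (∂-linkSum (tgt g) w e v (w≢π ∘ [ viaᵗ , to ]′ ∘ ∈-link⁻ _ w)))
         (*-zeroʳ (eval (linkSum (src g) w) v)))
  where
  viaˢ : src e ≡ src g × tgt e ≡ w → w ≡ pivot g e
  viaˢ (p , refl) with src e Fin.≟ src g | src e Fin.≟ tgt g
  ... | yes _ | _ = refl
  ... | no ¬p | _ = ⊥-elim (¬p p)

  viaᵗ : src e ≡ tgt g × tgt e ≡ w → w ≡ pivot g e
  viaᵗ (p , refl) with src e Fin.≟ src g | src e Fin.≟ tgt g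
  ... | yes _ | _     = refl
  ... | no _  | yes _ = refl
  ... | no _  | no ¬p = ⊥-elim (¬p p)

  to : ∀ {x} → src e ≡ w × tgt e ≡ x → w ≡ pivot g e
  to (refl , _) with src e Fin.≟ src g | src e Fin.≟ tgt g
  ... | yes p | _     = ⊥-elim (w≢s p)
  ... | no _  | yes p = ⊥-elim (w≢t p)
  ... | no _  | no _  = refl

-- The spine of the book is `g`; the factor at `w` stands for the page with apex `w`.
book : (D : ℕ) → Edge n → MultiAffine n
book {n} D g = ⨂ (allFin n) (allFin⁺ n) (pairFactor D g) (pivot g) (∂-pairFactor D g)

potential : (D n : ℕ) → MultiAffine n
potential D n = ⨁ (allEdges n) (book D)

-- Bounds for the potential

length-concatMap-≤ : ∀ {A B : Set} (f : A → List B) {b} → (∀ x → length (f x) ≤ b) →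
                     ∀ xs → length (concatMap f xs) ≤ length xs * b
length-concatMap-≤ f ≤b []       = z≤n
length-concatMap-≤ f ≤b (x ∷ xs) = ≤-trans (≤-reflexive (length-++ (f x)))
  (+-mono-≤ (≤b x) (length-concatMap-≤ f ≤b xs))

length-allFin : ∀ n → length (allFin n) ≡ n
length-allFin n = length-tabulate id

length-allEdges : ∀ n → length (allEdges n) ≤ n * n
length-allEdges n = begin
  length (allEdges n)     ≤⟨ length-concatMap-≤ _ (λ i → row i) (allFin n) ⟩
  length (allFin n) * n   ≡⟨ cong (_* n) (length-allFin n) ⟩
  n * n                   ∎
  where
  open ≤-Reasoning
  row : (i : Fin n) → length (concatMap (edgesBetween i) (allFin n)) ≤ n
  row i = ≤-trans (length-concatMap-≤ (edgesBetween i) (length-edgesBetween i) (allFin n))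
                  (≤-reflexive (trans (*-identityʳ _) (length-allFin n)))

-- A link has at most one edge, so each factor is at most `D + 1` while no variable exceeds 1, as on
-- the empty board.
eval-potential-≤ : ∀ D n {v} → (∀ e → v e ≤ 1) → eval (potential D n) v ≤ n * n * suc D ^ n
eval-potential-≤ D n {v} v≤1 = begin
  eval (potential D n) v           ≤⟨ eval-⨁-≤ (allEdges n) (book D) v book-≤ ⟩
  length (allEdges n) * suc D ^ n  ≤⟨ *-monoˡ-≤ (suc D ^ n) (length-allEdges n) ⟩
  n * n * suc D ^ n                ∎
  where
  open ≤-Reasoning
  book-≤ : ∀ g → eval (book D g) v ≤ suc D ^ n
  book-≤ g = ≤-trans
    (eval-⨂-≤ (allFin n) (allFin⁺ n) (pairFactor D g) (pivot g) (∂-pairFactor D g) v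
      λ w → ≤-trans (+-monoʳ-≤ D (*-mono-≤ (eval-linkSum-≤1 (src g) w v≤1) (eval-linkSum-≤1 (tgt g) w v≤1)))
                    (≤-reflexive (+-comm D 1)))
    (≤-reflexive (cong (suc D ^_) (length-allFin n)))

Adj : List (Edge n) → Fin n → Fin n → Set
Adj M i j = Any (_∈ M) (link i j)

Common : List (Edge n) → Edge n → Fin n → Set
Common M g w = Adj M (src g) w × Adj M (tgt g) w

common? : ∀ (M : List (Edge n)) g → Decidable (Common M g)
common? M g w = Any.any? (_∈? M) (link (src g) w) ×-dec Any.any? (_∈? M) (link (tgt g) w)

commonNbrs : List (Edge n) → Edge n → List (Fin n)
commonNbrs M g = filter (common? M g) (allFin _)

-- The book of `g` alone suffices: at a common neighbour both links contain an edge of value at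
-- least `b`, so the factor is at least `D + b * b`, hence at least twice `D`.
potential-≥ : ∀ D {n b} (M : List (Edge n)) v → D ≤ b * b → (∀ {e} → e ∈ M → b ≤ v e) → ∀ g →
              D ^ n * 2 ^ length (commonNbrs M g) ≤ eval (potential D n) v
potential-≥ D {n} {b} M v D≤b² M≥b g = begin
  D ^ n * 2 ^ length (commonNbrs M g)
    ≡⟨ cong (λ k → D ^ k * 2 ^ length (commonNbrs M g)) (sym (length-allFin n)) ⟩
  D ^ length (allFin n) * 2 ^ length (commonNbrs M g)
    ≤⟨ eval-⨂-≥ (allFin n) (allFin⁺ n) (pairFactor D g) (pivot g) (∂-pairFactor D g) v
         (common? M g) (λ w → m≤m+n D _)
         (λ {w} (p , q) → +-monoʳ-≤ D (≤-trans D≤b²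
           (*-mono-≤ (adj-≥ (src g) w p) (adj-≥ (tgt g) w q)))) ⟩
  eval (book D g) v
    ≤⟨ eval-⨁-∈ (book D) v (∈-allEdges g) ⟩
  eval (potential D n) v ∎
  where
  open ≤-Reasoning
  adj-≥ : ∀ i j → Adj M i j → b ≤ eval (linkSum i j) v
  adj-≥ i j a = let (e , e∈link , e∈M) = find a in ≤-trans (M≥b e∈M) (eval-⨁-∈ var v e∈link)

-- Breaker's claims

data Claim {n} (M : List (Edge n)) (B : List (Edge n)) : List (Edge n) → Set where
  claimed : ∀ {e} → Free M B e → Claim M B (e ∷ B)

Claims : List (Edge n) → List (Edge n) → List (Edge n) → Set
Claims M = Star (Claim M)

breakerClaims : ∀ {q} {M B B′ : List (Edge n)} → Claims M B B′ → AtBreaker q M B′ → AtBreaker q M B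
breakerClaims pass                win = win
breakerClaims (claimed free ◅ cs) win = claim _ free (breakerClaims cs win)

claims-⊆ : ∀ {M B B′ : List (Edge n)} → Claims M B B′ → B ⊆ B′
claims-⊆ pass             = id
claims-⊆ (claimed _ ◅ cs) = claims-⊆ cs ∘ there

#free-claims : ∀ {M B B′ : List (Edge n)} → Claims M B B′ → #free M B′ ≤ #free M B
#free-claims pass                = ≤-refl
#free-claims (claimed free ◅ cs) = ≤-trans (#free-claims cs) (<⇒≤ (#free-B free))

-- Beck's criterion: p greedy claims by Breaker compensate for a later claim by
-- Maker, which multiplies the value of a variable by 1 + p.
module Beck {n} (p : ℕ) (Φ : MultiAffine n) (β : ℕ) where

  -- The decisions are arguments so that `status-cong` can compare positions whose membership
  -- statements are merely equivalent.
  status : ∀ {P Q : Set} → Dec P → Dec Q → ℕ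
  status (yes _) _       = 1 + p
  status (no _)  (yes _) = 0
  status (no _)  (no _)  = 1

  status-cong : ∀ {P P′ Q Q′ : Set} → (P → P′) → (P′ → P) → (Q → Q′) → (Q′ → Q) →
                (P? : Dec P) (P′? : Dec P′) (Q? : Dec Q) (Q′? : Dec Q′) →
                status P? Q? ≡ status P′? Q′?
  status-cong f f′ g g′ (yes _) (yes _)   _       _        = refl
  status-cong f f′ g g′ (yes a) (no ¬a′)  _       _        = ⊥-elim (¬a′ (f a))
  status-cong f f′ g g′ (no ¬a) (yes a′)  _       _        = ⊥-elim (¬a (f′ a′))
  status-cong f f′ g g′ (no _)  (no _)    (yes _) (yes _)  = refl
  status-cong f f′ g g′ (no _)  (no _)    (yes b) (no ¬b′) = ⊥-elim (¬b′ (g b))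
  status-cong f f′ g g′ (no _)  (no _)    (no ¬b) (yes b′) = ⊥-elim (¬b (g′ b′))
  status-cong f f′ g g′ (no _)  (no _)    (no _)  (no _)   = refl

  board : (M B : List (Edge n)) → Valuation n
  board M B e = status (e ∈? M) (e ∈? B)

  board-free : ∀ {M B e} → Free M B e → board M B e ≡ 1
  board-free {M} {B} {e} (e∉M , e∉B) with e ∈? M | e ∈? B
  ... | yes e∈M | _       = ⊥-elim (e∉M e∈M)
  ... | no _    | yes e∈B = ⊥-elim (e∉B e∈B)
  ... | no _    | no _    = refl

  board-maker : ∀ {M B e} → e ∈ M → board M B e ≡ 1 + p
  board-maker {M} {B} {e} e∈M with e ∈? M
  ... | yes _  = refl
  ... | no e∉M = ⊥-elim (e∉M e∈M)

  board-breaker : ∀ {M B e} → e ∉ M → e ∈ B → board M B e ≡ 0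
  board-breaker {M} {B} {e} e∉M e∈B with e ∈? M | e ∈? B
  ... | yes e∈M | _      = ⊥-elim (e∉M e∈M)
  ... | no _    | yes _  = refl
  ... | no _    | no e∉B = ⊥-elim (e∉B e∈B)

  board-maker-else : ∀ M B {e f} → f ≢ e → board (e ∷ M) B f ≡ board M B f
  board-maker-else M B {e} {f} f≢e =
    status-cong (Any.tail f≢e) there id id (f ∈? (e ∷ M)) (f ∈? M) (f ∈? B) (f ∈? B)

  board-breaker-else : ∀ M B {e f} → f ≢ e → board M (e ∷ B) f ≡ board M B f
  board-breaker-else M B {e} {f} f≢e =
    status-cong id id (Any.tail f≢e) there (f ∈? M) (f ∈? M) (f ∈? (e ∷ B)) (f ∈? B)

  board-antitone : ∀ M B {e} → Free M B e → ∀ f → board M (e ∷ B) f ≤ board M B f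
  board-antitone M B {e} (e∉M , e∉B) f = by-cases (f ≟ᴱ e)
    where
    by-cases : Dec (f ≡ e) → board M (e ∷ B) f ≤ board M B f
    by-cases (no  f≢e)  = ≤-reflexive (board-breaker-else M B f≢e)
    by-cases (yes refl) = subst (_≤ board M B e) (sym (board-breaker {M} {e ∷ B} e∉M (here refl))) z≤n

  value : (M B : List (Edge n)) → ℕ
  value M B = eval Φ (board M B)

  weight : (M B : List (Edge n)) → Edge n → ℕ
  weight M B e = ∂ Φ e (board M B)

  value-maker : ∀ {M B e} → Free M B e → value (e ∷ M) B ≡ value M B + p * weight M B e
  value-maker {M} {B} {e} free = +-cancelʳ-≡ (weight M B e) _ _ (begin
    value (e ∷ M) B + weight M B e
      ≡⟨ affine Φ e (board-free free) (board-maker-else M B) ⟩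
    value M B + board (e ∷ M) B e * weight M B e
      ≡⟨ cong (λ x → value M B + x * weight M B e) (board-maker {e ∷ M} {B} (here refl)) ⟩
    value M B + (1 + p) * weight M B e
      ≡⟨ regroup (value M B) (weight M B e) p ⟩
    value M B + p * weight M B e + weight M B e ∎)
    where
    open ≡-Reasoning
    regroup : ∀ a w p → a + (1 + p) * w ≡ a + p * w + w
    regroup = solve-∀

  value-breaker : ∀ {M B e} → Free M B e → value M (e ∷ B) + weight M B e ≡ value M B
  value-breaker {M} {B} {e} free@(e∉M , _) = begin
    value M (e ∷ B) + weight M B e
      ≡⟨ affine Φ e (board-free free) (board-breaker-else M B) ⟩
    value M B + board M (e ∷ B) e * weight M B e
      ≡⟨ cong (λ x → value M B + x * weight M B e) (board-breaker {M} {e ∷ B} e∉M (here refl)) ⟩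
    value M B + 0
      ≡⟨ +-identityʳ _ ⟩
    value M B ∎
    where open ≡-Reasoning

  value-claims : ∀ {M B B′} → Claims M B B′ → value M B′ ≤ value M B
  value-claims pass = ≤-refl
  value-claims {M} {B} (claimed free ◅ cs) =
    ≤-trans (value-claims cs) (eval-mono Φ (board-antitone M B free))

  -- For `k = p` this says, by `value-maker`, that the value is still at most `β` after any next
  -- claim of Maker.
  Safe : ℕ → (M B : List (Edge n)) → Set
  Safe k M B = ∀ {e} → Free M B e → value M B + k * weight M B e ≤ β

  heaviest : ∀ M B → (∀ {e} → ¬ Free M B e) ⊎
             ∃[ f ] Free M B f × (∀ {e} → Free M B e → weight M B e ≤ weight M B f)
  heaviest M B with any-dec (free? M B)
  ... | no ¬free        = inj₁ λ free → ¬free (_ , free)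
  ... | yes (f₀ , free₀) = inj₂
    ( argmax (weight M B) f₀ frees
    , argmax-all (weight M B) free₀ (all-filter (free? M B) (allEdges n))
    , λ free → All.lookup (f[xs]≤f[argmax] f₀ frees) (∈-filter⁺ (free? M B) (∈-allEdges _) free))
    where
    frees : List (Edge n)
    frees = filter (free? M B) (allEdges n)

  -- Claiming a heaviest free edge `f` lowers the value by its weight. No remaining weight exceeds
  -- that of `f`, since weights only fall when Breaker claims; so the drop pays for one more
  -- multiple of any of them.
  greedy : ∀ k {M B} → value M B ≤ β →
           ∃[ B′ ] Claims M B B′ × Safe k M B′ × length B′ ≤ k + length B
  greedy zero {M} {B} ≤β = B , pass , (λ _ → ≤-trans (≤-reflexive (+-identityʳ _)) ≤β) , ≤-refl
  greedy (suc k) {M} {B} ≤β with greedy k {M} {B} ≤β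
  ... | B′ , cs , safe , len with heaviest M B′
  ...   | inj₁ none = B′ , cs , (λ free → ⊥-elim (none free)) , m≤n⇒m≤1+n len
  ...   | inj₂ (f , free-f , max) =
    f ∷ B′ , cs ◅◅ (claimed free-f ◅ pass) , safe′ , s≤s len
    where
    open ≤-Reasoning
    safe′ : Safe (suc k) M (f ∷ B′)
    safe′ {e} (e∉M , e∉fB′) = begin
      value M (f ∷ B′) + suc k * weight M (f ∷ B′) e
        ≤⟨ +-monoʳ-≤ (value M (f ∷ B′)) (*-monoʳ-≤ (suc k)
             (≤-trans (∂-mono Φ e (board-antitone M B′ free-f)) (max (e∉M , e∉fB′ ∘ there)))) ⟩
      value M (f ∷ B′) + suc k * weight M B′ f
        ≡⟨ sym (+-assoc (value M (f ∷ B′)) _ _) ⟩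
      value M (f ∷ B′) + weight M B′ f + k * weight M B′ f
        ≡⟨ cong (_+ k * weight M B′ f) (value-breaker free-f) ⟩
      value M B′ + k * weight M B′ f
        ≤⟨ safe free-f ⟩
      β ∎

  -- No greedy claims precede Maker's first move; the factor `1 + p` makes up for them, as a weight
  -- is at most the value.
  safe-start : (1 + p) * value [] [] ≤ β → Safe p [] []
  safe-start ≤β {e} free = ≤-trans
    (+-monoʳ-≤ (value [] []) (*-monoʳ-≤ p (∂≤eval Φ e (board-free free)))) ≤β

-- Counting threats

length-Unique-⊆ : {xs ys : List A} → Unique xs → xs ⊆ ys → length xs ≤ length ys
length-Unique-⊆ [] _ = z≤n
length-Unique-⊆ {xs = x ∷ xs} (x∉xs ∷ uniq) sub with ∈-∃++ (sub (here refl))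
... | as , bs , refl = ≤-trans (s≤s (length-Unique-⊆ uniq sub′))
    (≤-reflexive (trans (cong suc (length-++ as)) (trans (sym (+-suc (length as) _)) (sym (length-++ as)))))
  where
  sub′ : xs ⊆ as ++ bs
  sub′ {y} y∈ with ∈-++⁻ as (sub (there y∈))
  ... | inj₁ y∈as         = ∈-++⁺ˡ y∈as
  ... | inj₂ (here y≡x)   = ⊥-elim (All.lookup x∉xs y∈ (sym y≡x))
  ... | inj₂ (there y∈bs) = ∈-++⁺ʳ as y∈bs

pairs : List A → List (A × A)
pairs []       = []
pairs (x ∷ xs) = map (x ,_) xs ++ pairs xs

length-pairs : (xs : List A) → 2 * length (pairs xs) ≤ length xs * length xs
length-pairs []       = z≤n
length-pairs (x ∷ xs) = begin
  2 * length (map (x ,_) xs ++ pairs xs)      ≡⟨ cong (2 *_) (length-++ (map (x ,_) xs)) ⟩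
  2 * (length (map (x ,_) xs) + length (pairs xs))
    ≡⟨ cong (λ l → 2 * (l + length (pairs xs))) (length-map (x ,_) xs) ⟩
  2 * (length xs + length (pairs xs))         ≡⟨ *-distribˡ-+ 2 (length xs) _ ⟩
  2 * length xs + 2 * length (pairs xs)       ≤⟨ +-monoʳ-≤ (2 * length xs) (length-pairs xs) ⟩
  2 * length xs + length xs * length xs       ≤⟨ n≤1+n _ ⟩
  1 + (2 * length xs + length xs * length xs) ≡⟨ square (length xs) ⟩
  suc (length xs) * suc (length xs)           ∎
  where
  open ≤-Reasoning
  square : ∀ l → 1 + (2 * l + l * l) ≡ suc l * suc l
  square = solve-∀

∈-pairs⁺ : ∀ {x y} {xs : List A} → x ∈ xs → y ∈ xs → x ≢ y → (x , y) ∈ pairs xs ⊎ (y , x) ∈ pairs xs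
∈-pairs⁺ (here refl) (here refl) x≢y = ⊥-elim (x≢y refl)
∈-pairs⁺ (here refl) (there y∈)  x≢y = inj₁ (∈-++⁺ˡ (∈-map⁺ (_ ,_) y∈))
∈-pairs⁺ (there x∈)  (here refl) x≢y = inj₂ (∈-++⁺ˡ (∈-map⁺ (_ ,_) x∈))
∈-pairs⁺ {xs = z ∷ zs} (there x∈) (there y∈) x≢y with ∈-pairs⁺ x∈ y∈ x≢y
... | inj₁ xy∈ = inj₁ (∈-++⁺ʳ (map (z ,_) zs) xy∈)
... | inj₂ yx∈ = inj₂ (∈-++⁺ʳ (map (z ,_) zs) yx∈)

∈-pairs⁻ : ∀ {x y} (xs : List A) → (x , y) ∈ pairs xs → x ∈ xs × y ∈ xs
∈-pairs⁻ (z ∷ zs) xy∈ with ∈-++⁻ (map (z ,_) zs) xy∈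
... | inj₂ xy∈zs = let (x∈ , y∈) = ∈-pairs⁻ zs xy∈zs in there x∈ , there y∈
... | inj₁ xy∈z with ∈-map⁻ (z ,_) xy∈z
...   | _ , y∈ , refl = here refl , there y∈

link-swap : ∀ (i j : Fin n) → link i j ⊆ link j i
link-swap i j f∈ with ∈-++⁻ (edgesBetween i j) f∈
... | inj₁ f∈₁ = ∈-++⁺ʳ (edgesBetween j i) f∈₁
... | inj₂ f∈₂ = ∈-++⁺ˡ f∈₂

link-distinct : ∀ (i j : Fin n) {e} → e ∈ link i j → i ≢ j
link-distinct i j e∈ refl with () ← subst (_ ∈_) (link-refl i) e∈

-- The missing edges of the copies of K₄ minus an edge in M whose edge opposite
-- to the missing one is g.
threatsAt : List (Edge n) → Edge n → List (Edge n)
threatsAt M g = concatMap (uncurry link) (pairs (commonNbrs M g))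

threats : List (Edge n) → List (Edge n)
threats M = concatMap (threatsAt M) M

∈-threats⁺ : ∀ {M : List (Edge n)} {g f x y} → g ∈ M → Common M g x → Common M g y → f ∈ link x y →
             f ∈ threats M
∈-threats⁺ {M = M} {g} {f} {x} {y} g∈M cx cy f∈ = ∈-concatMap⁺ (threatsAt M) (lose g∈M at-g)
  where
  at-g : f ∈ threatsAt M g
  at-g with ∈-pairs⁺ (∈-filter⁺ (common? M g) (∈-allFin x) cx)
                     (∈-filter⁺ (common? M g) (∈-allFin y) cy) (link-distinct x y f∈)
  ... | inj₁ xy∈ = ∈-concatMap⁺ (uncurry link) (lose xy∈ f∈)
  ... | inj₂ yx∈ = ∈-concatMap⁺ (uncurry link) (lose yx∈ (link-swap x y f∈))

-- Threats persist as Maker's graph grows, so a claim once charged to a threat stays charged to it.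
threats-mono : ∀ {M M′ : List (Edge n)} → M ⊆ M′ → threats M ⊆ threats M′
threats-mono {M = M} {M′} M⊆M′ f∈ =
  let g , g∈ , f∈g         = find (∈-concatMap⁻ (threatsAt M) {xs = M} f∈)
      (x , y) , xy∈ , f∈xy = find (∈-concatMap⁻ (uncurry link) {xs = pairs (commonNbrs M g)} f∈g)
      x∈ , y∈              = ∈-pairs⁻ (commonNbrs M g) xy∈
  in ∈-threats⁺ (M⊆M′ g∈) (common-mono g x (proj₂ (∈-filter⁻ (common? M g) {xs = allFin _} x∈)))
                          (common-mono g y (proj₂ (∈-filter⁻ (common? M g) {xs = allFin _} y∈))) f∈xy
  where
  common-mono : ∀ g w → Common M g w → Common M′ g w
  common-mono g w (p , q) = Any.map M⊆M′ p , Any.map M⊆M′ q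

-- Each `g` in `M` has at most `t * t / 2` pairs of common neighbours, and each pair spans at most
-- one edge.
length-threats : ∀ (M : List (Edge n)) {t c} → t * t ≤ 2 * c → (∀ g → length (commonNbrs M g) ≤ t) →
                 length (threats M) ≤ length M * c
length-threats M {t} {c} t²≤2c nbrs≤t = length-concatMap-≤ (threatsAt M) at M
  where
  open ≤-Reasoning
  at : ∀ g → length (threatsAt M g) ≤ c
  at g = *-cancelˡ-≤ 2 (begin
    2 * length (threatsAt M g)
      ≤⟨ *-monoʳ-≤ 2 (length-concatMap-≤ (uncurry link) (uncurry length-link) (pairs (commonNbrs M g))) ⟩
    2 * (length (pairs (commonNbrs M g)) * 1) ≡⟨ cong (2 *_) (*-identityʳ (length (pairs (commonNbrs M g)))) ⟩
    2 * length (pairs (commonNbrs M g))       ≤⟨ length-pairs (commonNbrs M g) ⟩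
    length (commonNbrs M g) * length (commonNbrs M g) ≤⟨ *-mono-≤ (nbrs≤t g) (nbrs≤t g) ⟩
    t * t                                     ≤⟨ t²≤2c ⟩
    2 * c ∎)

-- Breaker's strategy

NoK₄ : List (Edge n) → Set
NoK₄ {n} M = (K : K₄ n) → ¬ All (_∈ M) (edges K)

edge-∈⇒Adj : ∀ {M : List (Edge n)} (i j : Fin n) .(i<j : i Fin.< j) → edge i j i<j ∈ M →
             Adj M i j × Adj M j i
edge-∈⇒Adj i j i<j e∈M = let (ij , ji) = ∈-link⁺ i j i<j in lose ij e∈M , lose ji e∈M

src≢ : ∀ (e f : Edge n) → .(src e Fin.< src f) → e ≢ f
src≢ e .e lt refl = ⊥-elim-irr (<-irrefl refl lt)

tgt≢ : ∀ (e f : Edge n) → .(tgt e Fin.< tgt f) → e ≢ f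
tgt≢ e .e lt refl = ⊥-elim-irr (<-irrefl refl lt)

edges-unique : (K : K₄ n) → Unique (edges K)
edges-unique (k₄ a b c d a<b b<c c<d) =
    (tgt≢ ab ac b<c ∷ tgt≢ ab ad (<-trans b<c c<d) ∷ src≢ ab bc a<b ∷ src≢ ab bd a<b ∷ src≢ ab cd (<-trans a<b b<c) ∷ [])
  ∷ (tgt≢ ac ad c<d ∷ src≢ ac bc a<b ∷ src≢ ac bd a<b ∷ src≢ ac cd (<-trans a<b b<c) ∷ [])
  ∷ (src≢ ad bc a<b ∷ src≢ ad bd a<b ∷ src≢ ad cd (<-trans a<b b<c) ∷ [])
  ∷ (tgt≢ bc bd c<d ∷ src≢ bc cd b<c ∷ [])
  ∷ (src≢ bd cd b<c ∷ [])
  ∷ [] ∷ []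
  where
  ab ac ad bc bd cd : Edge _
  ab = edge a b a<b
  ac = edge a c (<-trans a<b b<c)
  ad = edge a d (<-trans a<b (<-trans b<c c<d))
  bc = edge b c b<c
  bd = edge b d (<-trans b<c c<d)
  cd = edge c d c<d

-- The edge of `K` disjoint from `e` lies in `M`, and both ends of `e` are common neighbours of it.
threatened : ∀ {M : List (Edge n)} (K : K₄ n) {e} → e ∈ edges K →
             (∀ {f} → f ∈ edges K → f ≢ e → f ∈ M) → e ∈ threats M
threatened {n} {M} K@(k₄ a b c d a<b b<c c<d) {e} e∈K rest with edges-unique K
... |   (ab≢ac ∷ ab≢ad ∷ ab≢bc ∷ ab≢bd ∷ ab≢cd ∷ [])
      ∷ (ac≢ad ∷ ac≢bc ∷ ac≢bd ∷ ac≢cd ∷ [])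
      ∷ (ad≢bc ∷ ad≢bd ∷ ad≢cd ∷ [])
      ∷ (bc≢bd ∷ bc≢cd ∷ []) ∷ (bd≢cd ∷ []) ∷ [] ∷ [] = by-position e∈K rest
  where
  ab∈ : ∀ {x} {xs : List (Edge n)} → x ∈ x ∷ xs
  ab∈ = here refl
  ac∈ : ∀ {x y} {xs : List (Edge n)} → x ∈ y ∷ x ∷ xs
  ac∈ = there ab∈
  ad∈ : ∀ {x y z} {xs : List (Edge n)} → x ∈ y ∷ z ∷ x ∷ xs
  ad∈ = there ac∈
  bc∈ : ∀ {x y z u} {xs : List (Edge n)} → x ∈ y ∷ z ∷ u ∷ x ∷ xs
  bc∈ = there ad∈
  bd∈ : ∀ {x y z u v} {xs : List (Edge n)} → x ∈ y ∷ z ∷ u ∷ v ∷ x ∷ xs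
  bd∈ = there bc∈
  cd∈ : ∀ {x y z u v w} {xs : List (Edge n)} → x ∈ y ∷ z ∷ u ∷ v ∷ w ∷ x ∷ xs
  cd∈ = there bd∈

  up : ∀ {i j : Fin n} → .(i<j : i Fin.< j) → edge i j i<j ∈ M → Adj M i j
  up i<j e∈M = proj₁ (edge-∈⇒Adj _ _ i<j e∈M)
  down : ∀ {i j : Fin n} → .(i<j : i Fin.< j) → edge i j i<j ∈ M → Adj M j i
  down i<j e∈M = proj₂ (edge-∈⇒Adj _ _ i<j e∈M)

  by-position : ∀ {e} → e ∈ edges K → (∀ {f} → f ∈ edges K → f ≢ e → f ∈ M) → e ∈ threats M
  by-position (here refl) rest = ∈-threats⁺ {x = a} {b} (rest cd∈ (≢-sym ab≢cd))
    (down (<-trans a<b b<c) (rest ac∈ (≢-sym ab≢ac)) , down (<-trans a<b (<-trans b<c c<d)) (rest ad∈ (≢-sym ab≢ad)))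
    (down b<c (rest bc∈ (≢-sym ab≢bc)) , down (<-trans b<c c<d) (rest bd∈ (≢-sym ab≢bd)))
    (proj₁ (∈-link⁺ a b a<b))
  by-position (there (here refl)) rest = ∈-threats⁺ {x = a} {c} (rest bd∈ (≢-sym ac≢bd))
    (down a<b (rest ab∈ ab≢ac) , down (<-trans a<b (<-trans b<c c<d)) (rest ad∈ (≢-sym ac≢ad)))
    (up b<c (rest bc∈ (≢-sym ac≢bc)) , down c<d (rest cd∈ (≢-sym ac≢cd)))
    (proj₁ (∈-link⁺ a c (<-trans a<b b<c)))
  by-position (there (there (here refl))) rest = ∈-threats⁺ {x = a} {d} (rest bc∈ (≢-sym ad≢bc))
    (down a<b (rest ab∈ ab≢ad) , down (<-trans a<b b<c) (rest ac∈ ac≢ad))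
    (up (<-trans b<c c<d) (rest bd∈ (≢-sym ad≢bd)) , up c<d (rest cd∈ (≢-sym ad≢cd)))
    (proj₁ (∈-link⁺ a d (<-trans a<b (<-trans b<c c<d))))
  by-position (there (there (there (here refl)))) rest = ∈-threats⁺ {x = b} {c} (rest ad∈ ad≢bc)
    (up a<b (rest ab∈ ab≢bc) , down (<-trans b<c c<d) (rest bd∈ (≢-sym bc≢bd)))
    (up (<-trans a<b b<c) (rest ac∈ ac≢bc) , down c<d (rest cd∈ (≢-sym bc≢cd)))
    (proj₁ (∈-link⁺ b c b<c))
  by-position (there (there (there (there (here refl))))) rest = ∈-threats⁺ {x = b} {d} (rest ac∈ ac≢bd)
    (up a<b (rest ab∈ ab≢bd) , down b<c (rest bc∈ bc≢bd))
    (up (<-trans a<b (<-trans b<c c<d)) (rest ad∈ ad≢bd) , up c<d (rest cd∈ (≢-sym bd≢cd)))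
    (proj₁ (∈-link⁺ b d (<-trans b<c c<d)))
  by-position (there (there (there (there (there (here refl)))))) rest = ∈-threats⁺ {x = c} {d} (rest ab∈ ab≢cd)
    (up (<-trans a<b b<c) (rest ac∈ ac≢cd) , up b<c (rest bc∈ bc≢cd))
    (up (<-trans a<b (<-trans b<c c<d)) (rest ad∈ ad≢cd) , up (<-trans b<c c<d) (rest bd∈ bd≢cd))
    (proj₁ (∈-link⁺ c d c<d))

-- The claims in reserve answer distinct threats in T; the other claims, at most
-- k many, are made for the potential.
record Budget (T : List (Edge n)) (k : ℕ) (B : List (Edge n)) : Set where
  field
    reserve   : List (Edge n)
    unique    : Unique reserve
    reserve⊆T : reserve ⊆ T
    reserve⊆B : reserve ⊆ B
    length≤   : length B ≤ k + length reserve

open Budget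

-- The reserve is free of repetitions and lies in `T`, so the answers of the whole game together
-- cost at most the current number of threats.
length-budget : ∀ {T B : List (Edge n)} {k} → Budget T k B → length B ≤ k + length T
length-budget {k = k} b =
  ≤-trans (length≤ b) (+-monoʳ-≤ k (length-Unique-⊆ (unique b) (reserve⊆T b)))

-- Edges already taken are skipped and every new claim enters the reserve, so the allowance `k` for
-- the potential is untouched.
answer : ∀ {M B T : List (Edge n)} {k} (xs : List (Edge n)) → xs ⊆ T → Budget T k B →
         ∃[ B′ ] Claims M B B′ × Budget T k B′ × (∀ {f} → f ∈ xs → f ∈ B′ ⊎ f ∈ M)
answer [] _ b = _ , pass , b , λ ()
answer {M = M} {B} {k = k} (x ∷ xs) xs⊆T b with x ∈? M | x ∈? B
... | yes x∈M | _ =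
  let B′ , cs , b′ , done = answer xs (xs⊆T ∘ there) b
  in B′ , cs , b′ , λ { (here refl) → inj₂ x∈M ; (there f∈) → done f∈ }
... | no _ | yes x∈B =
  let B′ , cs , b′ , done = answer xs (xs⊆T ∘ there) b
  in B′ , cs , b′ , λ { (here refl) → inj₁ (claims-⊆ cs x∈B) ; (there f∈) → done f∈ }
... | no x∉M | no x∉B =
  let B′ , cs , b′ , done = answer xs (xs⊆T ∘ there) b⁺
  in B′ , claimed (x∉M , x∉B) ◅ cs , b′ ,
     λ { (here refl) → inj₁ (claims-⊆ cs (here refl)) ; (there f∈) → done f∈ }
  where
  b⁺ : Budget _ k (x ∷ B)
  b⁺ = record
    { reserve   = x ∷ reserve b
    -- The reserve lies in `B`, which does not contain `x`.
    ; unique    = All.tabulate (λ { y∈ refl → x∉B (reserve⊆B b y∈) }) ∷ unique b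
    ; reserve⊆T = λ { (here refl) → xs⊆T (here refl) ; (there y∈) → reserve⊆T b y∈ }
    ; reserve⊆B = λ { (here refl) → here refl ; (there y∈) → there (reserve⊆B b y∈) }
    ; length≤   = ≤-trans (s≤s (length≤ b)) (≤-reflexive (sym (+-suc k _)))
    }

-- Here `t` bounds the codegrees and `c` the number of threats per Maker edge. By `small`, the cap
-- `β` on the potential lies below the value that codegree `t` would force.
module Strategy {n p t c : ℕ} (t²≤2c : t * t ≤ 2 * c)
  (small : (1 + p) * (n * n * suc (p * p) ^ n) < (p * p) ^ n * 2 ^ t) where

  D β : ℕ
  D = p * p
  β = (1 + p) * (n * n * suc D ^ n)

  open Beck {n} p (potential D n) β

  -- The invariant of the positions with Maker to move.
  record Guarded (M B : List (Edge n)) : Set where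
    field
      noK₄     : NoK₄ M
      answered : ∀ {f} → f ∈ threats M → f ∈ B ⊎ f ∈ M
      budget   : Budget (threats M) (p * length M) B
      safe     : Safe p M B

  open Guarded

  commonNbrs-≤ : ∀ {M B} → value M B ≤ β → ∀ g → length (commonNbrs M g) ≤ t
  commonNbrs-≤ {M} {B} ≤β g = ≮⇒≥ λ t<nbrs → <-irrefl refl (begin-strict
    β                                   <⟨ small ⟩
    D ^ n * 2 ^ t                       ≤⟨ *-monoʳ-≤ (D ^ n) (^-monoʳ-≤ 2 (<⇒≤ t<nbrs)) ⟩
    D ^ n * 2 ^ length (commonNbrs M g) ≤⟨ potential-≥ D M (board M B) D≤ (λ e∈M → ≤-reflexive (sym (board-maker {M} {B} e∈M))) g ⟩
    value M B                           ≤⟨ ≤β ⟩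
    β                                   ∎)
    where
    open ≤-Reasoning
    D≤ : D ≤ (1 + p) * (1 + p)
    D≤ = *-mono-≤ (n≤1+n p) (n≤1+n p)

  -- An edge completing a K₄ was a threat before the move, hence answered, hence not free.
  noK₄-maker : ∀ {M B e} → Guarded M B → Free M B e → NoK₄ (e ∷ M)
  noK₄-maker {M} {B} {e} inv (e∉M , e∉B) K K⊆eM
    with find (¬All⇒Any¬ (_∈? M) (edges K) (noK₄ inv K))
  ... | x , x∈K , x∉M with All.lookup K⊆eM x∈K
  ...   | there x∈M = x∉M x∈M
  ...   | here refl = [ e∉B , e∉M ]′ (answered inv
    (threatened K x∈K λ f∈K f≢e → Any.tail f≢e (All.lookup K⊆eM f∈K)))

  -- Breaker first answers the threats, which cannot raise the potential, and then makes his `p`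
  -- greedy claims.
  respond : ∀ {M B e} → Guarded M B → Free M B e →
            ∃[ B′ ] Claims (e ∷ M) B B′ × Guarded (e ∷ M) B′ × length B′ ≤ (p + c) * length (e ∷ M)
  respond {M} {B} {e} inv free = B₂ , cs₁ ◅◅ cs₂ , record
    { noK₄     = noK₄-maker inv free
    ; answered = λ f∈ → [ (λ f∈B₁ → inj₁ (claims-⊆ cs₂ f∈B₁)) , inj₂ ]′ (done f∈)
    ; budget   = b₂
    ; safe     = safe₂
    } , (begin
      length B₂                                     ≤⟨ length-budget b₂ ⟩
      p * length M′ + length (threats M′)
        -- Codegrees depend on Maker's graph only, so they are bounded directly after her claim,
        -- where `safe` keeps the value at most `β`.
        ≤⟨ +-monoʳ-≤ (p * length M′) (length-threats M′ t²≤2c (commonNbrs-≤ {M′} {B} value≤β)) ⟩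
      p * length M′ + length M′ * c                 ≡⟨ regroup p (length M′) c ⟩
      (p + c) * length M′                           ∎)
    where
    open ≤-Reasoning
    M′ : List (Edge n)
    M′ = e ∷ M

    regroup : ∀ p m c → p * m + m * c ≡ (p + c) * m
    regroup = solve-∀

    value≤β : value M′ B ≤ β
    value≤β = ≤-trans (≤-reflexive (value-maker free)) (safe inv free)

    b₀ : Budget (threats M′) (p * length M) B
    b₀ = record { Budget (budget inv)
                ; reserve⊆T = λ f∈ → threats-mono there (reserve⊆T (budget inv) f∈) }

    answers = answer {M = M′} (threats M′) id b₀
    B₁   = proj₁ answers
    cs₁  = proj₁ (proj₂ answers)
    b₁   = proj₁ (proj₂ (proj₂ answers))
    done = proj₂ (proj₂ (proj₂ answers))

    greedily = greedy p {M′} {B₁} (≤-trans (value-claims cs₁) value≤β)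
    B₂    = proj₁ greedily
    cs₂   = proj₁ (proj₂ greedily)
    safe₂ : Safe p M′ B₂
    safe₂ = proj₁ (proj₂ (proj₂ greedily))

    b₂ : Budget (threats M′) (p * length M′) B₂
    b₂ = record
      { Budget b₁
      ; reserve⊆B = λ f∈ → claims-⊆ cs₂ (reserve⊆B b₁ f∈)
      -- The greedy claims stay outside the reserve; they raise the allowance from `p * length M` to
      -- `p * length M′`.
      ; length≤   = begin
          length B₂                                    ≤⟨ proj₂ (proj₂ (proj₂ greedily)) ⟩
          p + length B₁                                ≤⟨ +-monoʳ-≤ p (length≤ b₁) ⟩
          p + (p * length M + length (reserve b₁))     ≡⟨ sym (+-assoc p _ _) ⟩
          p + p * length M + length (reserve b₁)       ≡⟨ cong (_+ length (reserve b₁)) (sym (*-suc p (length M))) ⟩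
          p * length M′ + length (reserve b₁)          ∎
      }

  -- Induction on a bound for the number of free edges. On a full board every edge outside `M` is
  -- Breaker's, so `NoK₄ M` means that all copies are blocked.
  wins : ∀ k {M B} → #free M B ≤ k → Guarded M B → AtMaker (p + c) M B
  wins k {M} {B} ≤k inv with any-dec (free? M B)
  ... | no full = blocked λ K →
    let x , x∈K , x∉M = find (¬All⇒Any¬ (_∈? M) (edges K) (noK₄ inv K))
    in lose x∈K (claimed-by-breaker x∉M)
    where
    claimed-by-breaker : ∀ {x} → x ∉ M → x ∈ B
    claimed-by-breaker {x} x∉M with x ∈? B
    ... | yes x∈B = x∈B
    ... | no  x∉B = ⊥-elim (full (x , x∉M , x∉B))
  wins zero    ≤0   inv | yes (_ , free) = ⊥-elim (n≮0 (<-≤-trans (#free-M free) ≤0))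
  wins (suc k) ≤1+k inv | yes ex = reply ex λ e free →
    let B′ , cs , inv′ , len = respond inv free
    in breakerClaims cs (endTurn len
         (wins k (≤-trans (#free-claims cs) (≤-pred (<-≤-trans (#free-M free) ≤1+k))) inv′))

  breakerWins : BreakerWins n (p + c)
  breakerWins = wins _ ≤-refl record
    { noK₄     = λ { K (() ∷ _) }
    ; answered = λ ()
    ; budget   = record
        { reserve = [] ; unique = [] ; reserve⊆T = λ () ; reserve⊆B = λ () ; length≤ = z≤n }
    ; safe     = safe-start (*-monoʳ-≤ (1 + p)
        (eval-potential-≤ D n λ e → ≤-reflexive (board-free {[]} {[]} {e} ((λ ()) , λ ()))))
    }

-- Choice of the parameters

-- This is `(1 + 1/D)^j ≤ D / (D − j)`; the induction uses `(D + 1) k ≤ D (k + 1)`, valid because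
-- `k ≤ D`.
bernoulli : ∀ {D} j k → D ≡ j + k → suc D ^ j * k ≤ D ^ suc j
bernoulli {D} zero k refl = ≤-reflexive (trans (*-identityˡ D) (sym (*-identityʳ D)))
bernoulli {D} (suc j) k refl = begin
  suc D * suc D ^ j * k    ≡⟨ regroup (suc D) (suc D ^ j) k ⟩
  suc D ^ j * (suc D * k)  ≤⟨ *-monoʳ-≤ (suc D ^ j) (≤-trans (+-monoˡ-≤ (D * k) (m≤n+m k (suc j))) (≤-reflexive (sym (*-suc D k)))) ⟩
  suc D ^ j * (D * suc k)  ≡⟨ regroup′ (suc D ^ j) D (suc k) ⟩
  D * (suc D ^ j * suc k)  ≤⟨ *-monoʳ-≤ D (bernoulli {D} j (suc k) (sym (+-suc j k))) ⟩
  D * D ^ suc j            ∎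
  where
  open ≤-Reasoning
  regroup : ∀ a b k → a * b * k ≡ b * (a * k)
  regroup = solve-∀
  regroup′ : ∀ a b k → a * (b * k) ≡ b * (a * k)
  regroup′ = solve-∀

*-^-distrib : ∀ a b k → (a * b) ^ k ≡ a ^ k * b ^ k
*-^-distrib a b zero    = refl
*-^-distrib a b (suc k) = trans (cong (a * b *_) (*-^-distrib a b k)) (interchange a b (a ^ k) (b ^ k))
  where
  interchange : ∀ a b x y → a * b * (x * y) ≡ a * x * (b * y)
  interchange = solve-∀

-- (1 + 1/D)ⁿ ≤ (4/3)ᵏ for D = 4 m and n ≤ m k.
growth : ∀ m n k .{{_ : NonZero m}} → n ≤ m * k →
         suc (4 * m) ^ n * 3 ^ k ≤ (4 * m) ^ n * 4 ^ k
-- Multiplying by `D ^ l` pads the exponent `n` to `m * k`, that is, to `k` blocks of length `m`.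
growth m n k n≤mk = *-cancelʳ-≤ _ _ (D ^ l) {{m^n≢0 D l {{m*n≢0 4 m}}}} (begin
  suc D ^ n * 3 ^ k * D ^ l     ≤⟨ *-monoʳ-≤ (suc D ^ n * 3 ^ k) (^-monoˡ-≤ l (n≤1+n D)) ⟩
  suc D ^ n * 3 ^ k * suc D ^ l ≡⟨ collect (suc D) (3 ^ k) ⟩
  suc D ^ (m * k) * 3 ^ k       ≡⟨ cong (_* 3 ^ k) (sym (^-*-assoc (suc D) m k)) ⟩
  (suc D ^ m) ^ k * 3 ^ k       ≡⟨ sym (*-^-distrib (suc D ^ m) 3 k) ⟩
  (suc D ^ m * 3) ^ k           ≤⟨ ^-monoˡ-≤ k base ⟩
  (D ^ m * 4) ^ k               ≡⟨ *-^-distrib (D ^ m) 4 k ⟩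
  (D ^ m) ^ k * 4 ^ k           ≡⟨ cong (_* 4 ^ k) (^-*-assoc D m k) ⟩
  D ^ (m * k) * 4 ^ k           ≡⟨ sym (collect D (4 ^ k)) ⟩
  D ^ n * 4 ^ k * D ^ l         ∎)
  where
  open ≤-Reasoning
  D l : ℕ
  D = 4 * m
  l = m * k ∸ n

  swap : ∀ a b c → a * b * c ≡ a * c * b
  swap = solve-∀

  collect : ∀ a b → a ^ n * b * a ^ l ≡ a ^ (m * k) * b
  collect a b = trans (swap (a ^ n) b (a ^ l)) (cong (_* b)
    (trans (sym (^-distribˡ-+-* a n l)) (cong (a ^_) (m+[n∸m]≡n n≤mk))))

  -- One block: `bernoulli` with `j = m` bounds the ratio by `4m / 3m`.
  base : suc D ^ m * 3 ≤ D ^ m * 4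
  base = *-cancelʳ-≤ _ _ m (begin
    suc D ^ m * 3 * m   ≡⟨ *-assoc (suc D ^ m) 3 m ⟩
    suc D ^ m * (3 * m) ≤⟨ bernoulli {D} m (3 * m) (split m) ⟩
    D * D ^ m           ≡⟨ regroup (D ^ m) m ⟩
    D ^ m * 4 * m       ∎)
    where
    split : ∀ m → 4 * m ≡ m + 3 * m
    split = solve-∀
    regroup : ∀ x m → 4 * m * x ≡ x * 4 * m
    regroup = solve-∀

-- The ratio ((r + 1) / r)ᵉ decreases in r.
succ-^-≤ : ∀ a b K e {r} .{{_ : NonZero K}} → a * suc K ^ e ≤ b * K ^ e → K ≤ r →
           a * suc r ^ e ≤ b * r ^ e
succ-^-≤ a b K e {r} at-K K≤r = *-cancelʳ-≤ _ _ (K ^ e) {{m^n≢0 K e}} (begin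
  a * suc r ^ e * K ^ e   ≡⟨ *-assoc a (suc r ^ e) (K ^ e) ⟩
  a * (suc r ^ e * K ^ e) ≡⟨ cong (a *_) (sym (*-^-distrib (suc r) K e)) ⟩
  a * (suc r * K) ^ e     ≤⟨ *-monoʳ-≤ a (^-monoˡ-≤ e (+-mono-≤ K≤r (≤-reflexive (*-comm r K)))) ⟩
  a * (suc K * r) ^ e     ≡⟨ cong (a *_) (*-^-distrib (suc K) r e) ⟩
  a * (suc K ^ e * r ^ e) ≡⟨ sym (*-assoc a (suc K ^ e) (r ^ e)) ⟩
  a * suc K ^ e * r ^ e   ≤⟨ *-monoˡ-≤ (r ^ e) at-K ⟩
  b * K ^ e * r ^ e       ≡⟨ swap b (K ^ e) (r ^ e) ⟩
  b * r ^ e * K ^ e       ∎)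
  where
  open ≤-Reasoning
  swap : ∀ a b c → a * b * c ≡ a * c * b
  swap = solve-∀

-- Induction from `r = 400`, where the inequality is evaluated. A step multiplies `r ^ 12` by at
-- most `(401/400)^12`, which is below `81/64`.
exp-dominates : ∀ d → let r = d + 400 in 9072 * r ^ 12 * 64 ^ r < 81 ^ r
exp-dominates zero    = <ᵇ⇒< (9072 * 400 ^ 12 * 64 ^ 400) (81 ^ 400) _
exp-dominates (suc d) = step (d + 400) (m≤n+m 400 d) (exp-dominates d)
  where
  open ≤-Reasoning
  step : ∀ r → 400 ≤ r → 9072 * r ^ 12 * 64 ^ r < 81 ^ r →
         9072 * suc r ^ 12 * 64 ^ suc r < 81 ^ suc r
  step r 400≤r ih = begin-strict
    9072 * suc r ^ 12 * (64 * 64 ^ r) ≡⟨ regroup 9072 (suc r ^ 12) 64 (64 ^ r) ⟩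
    9072 * (64 * suc r ^ 12) * 64 ^ r
      ≤⟨ *-monoˡ-≤ (64 ^ r) (*-monoʳ-≤ 9072
           (succ-^-≤ 64 81 400 12 (≤ᵇ⇒≤ (64 * 401 ^ 12) (81 * 400 ^ 12) _) 400≤r)) ⟩
    9072 * (81 * r ^ 12) * 64 ^ r     ≡⟨ regroup′ 9072 81 (r ^ 12) (64 ^ r) ⟩
    81 * (9072 * r ^ 12 * 64 ^ r)     <⟨ *-monoʳ-< 81 ih ⟩
    81 * 81 ^ r                       ∎
    where
    regroup : ∀ a b c d → a * b * (c * d) ≡ a * (c * b) * d
    regroup = solve-∀
    regroup′ : ∀ a b c d → a * (b * c) * d ≡ b * (a * c * d)
    regroup′ = solve-∀

-- With `D = 4m` and `n ≤ m * 4r`, the growth `(1 + 1/D)^n` is at most `(4/3)^(4r) = (256/81)^r`.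
-- Against `2^t = 4^r` this leaves a factor `(81/64)^r` to absorb the polynomial `(1 + p) n²`.
bias-suffices : ∀ {n r} → 400 ≤ r → n ≤ (2 * suc r) ^ 5 → BreakerWins n (8 * (r * r))
bias-suffices {n} {r} 400≤r n≤ = subst (BreakerWins n) (8rr r)
  (Strategy.breakerWins {n} {p} {2 * r} {2 * (r * r)} (≤-reflexive (square r))
    (*-cancelˡ-< (81 ^ r) _ _ small))
  where
  open ≤-Reasoning
  p D m : ℕ
  p = 6 * (r * r)
  D = p * p
  m = 9 * (r * r * (r * r))

  instance
    r≢0 : NonZero r
    r≢0 = >-nonZero (<-≤-trans z<s 400≤r)
    rr≢0 : NonZero (r * r)
    rr≢0 = m*n≢0 r r
    m≢0 : NonZero m
    m≢0 = m*n≢0 9 (r * r * (r * r)) {{_}} {{m*n≢0 (r * r) (r * r)}}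

  8rr : ∀ r → 6 * (r * r) + 2 * (r * r) ≡ 8 * (r * r)
  8rr = solve-∀

  square : ∀ r → 2 * r * (2 * r) ≡ 2 * (2 * (r * r))
  square = solve-∀

  D≡4m : D ≡ 4 * m
  D≡4m = eq r
    where
    eq : ∀ r → 6 * (r * r) * (6 * (r * r)) ≡ 4 * (9 * (r * r * (r * r)))
    eq = solve-∀

  n≤36r⁵ : n ≤ 36 * r ^ 5
  n≤36r⁵ = begin
    n                ≤⟨ n≤ ⟩
    (2 * suc r) ^ 5  ≡⟨ *-^-distrib 2 (suc r) 5 ⟩
    -- Passing from `r + 1` to `r` costs a factor below `36/32` once `r` is at least 400.
    32 * suc r ^ 5   ≤⟨ succ-^-≤ 32 36 400 5 {r} (≤ᵇ⇒≤ (32 * 401 ^ 5) (36 * 400 ^ 5) _) 400≤r ⟩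
    36 * r ^ 5       ∎

  grown : suc D ^ n * 81 ^ r ≤ D ^ n * 256 ^ r
  grown = begin
    suc D ^ n * 81 ^ r              ≡⟨ cong₂ (λ d x → suc d ^ n * x) D≡4m (^-*-assoc 3 4 r) ⟩
    suc (4 * m) ^ n * 3 ^ (4 * r)   ≤⟨ growth m n (4 * r) (≤-trans n≤36r⁵ (≤-reflexive (eq r))) ⟩
    (4 * m) ^ n * 4 ^ (4 * r)       ≡⟨ sym (cong₂ (λ d x → d ^ n * x) D≡4m (^-*-assoc 4 4 r)) ⟩
    D ^ n * 256 ^ r                 ∎
    where
    eq : ∀ r → 36 * (r * (r * (r * (r * (r * 1))))) ≡ 9 * (r * r * (r * r)) * (4 * r)
    eq = solve-∀

  polynomial : (1 + p) * (n * n) ≤ 9072 * r ^ 12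
  polynomial = begin
    (1 + p) * (n * n)
      -- Since `1 ≤ r * r`, the first factor is at most `7 r²`, and `7 * 36² = 9072`.
      ≤⟨ *-mono-≤ (+-monoˡ-≤ p (>-nonZero⁻¹ (r * r))) (*-mono-≤ n≤36r⁵ n≤36r⁵) ⟩
    (r * r + p) * (36 * r ^ 5 * (36 * r ^ 5)) ≡⟨ eq r (r ^ 5) ⟩
    9072 * (r * (r * (r ^ 5 * r ^ 5)))
      ≡⟨ cong (λ x → 9072 * (r * (r * x))) (sym (^-distribˡ-+-* r 5 5)) ⟩
    9072 * r ^ 12 ∎
    where
    eq : ∀ r x → (r * r + 6 * (r * r)) * (36 * x * (36 * x)) ≡ 9072 * (r * (r * (x * x)))
    eq = solve-∀

  dominated : 9072 * r ^ 12 * 64 ^ r < 81 ^ r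
  dominated = subst (λ r → 9072 * r ^ 12 * 64 ^ r < 81 ^ r) (m∸n+n≡m 400≤r) (exp-dominates (r ∸ 400))

  small : 81 ^ r * ((1 + p) * (n * n * suc D ^ n)) < 81 ^ r * (D ^ n * 2 ^ (2 * r))
  small = begin-strict
    81 ^ r * ((1 + p) * (n * n * suc D ^ n)) ≡⟨ regroup₁ (81 ^ r) (1 + p) (n * n) (suc D ^ n) ⟩
    (1 + p) * (n * n) * (suc D ^ n * 81 ^ r) ≤⟨ *-mono-≤ polynomial grown ⟩
    9072 * r ^ 12 * (D ^ n * 256 ^ r)        ≡⟨ cong (λ x → 9072 * r ^ 12 * (D ^ n * x)) (*-^-distrib 4 64 r) ⟩
    9072 * r ^ 12 * (D ^ n * (4 ^ r * 64 ^ r)) ≡⟨ regroup₂ (9072 * r ^ 12) (D ^ n) (4 ^ r) (64 ^ r) ⟩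
    D ^ n * 4 ^ r * (9072 * r ^ 12 * 64 ^ r) <⟨ *-monoʳ-< (D ^ n * 4 ^ r) {{D^n4^r≢0}} dominated ⟩
    D ^ n * 4 ^ r * 81 ^ r                   ≡⟨ *-comm (D ^ n * 4 ^ r) (81 ^ r) ⟩
    81 ^ r * (D ^ n * 4 ^ r)                 ≡⟨ cong (λ x → 81 ^ r * (D ^ n * x)) (^-*-assoc 2 2 r) ⟩
    81 ^ r * (D ^ n * 2 ^ (2 * r))           ∎
    where
    D^n4^r≢0 : NonZero (D ^ n * 4 ^ r)
    D^n4^r≢0 = m*n≢0 (D ^ n) (4 ^ r)
      {{m^n≢0 D n {{m*n≢0 p p {{m*n≢0 6 (r * r)}} {{m*n≢0 6 (r * r)}}}}}} {{m^n≢0 4 r}}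
    regroup₁ : ∀ a b c d → a * (b * (c * d)) ≡ b * c * (d * a)
    regroup₁ = solve-∀
    regroup₂ : ∀ a b c d → a * (b * (c * d)) ≡ b * c * (a * d)
    regroup₂ = solve-∀

-- An even root makes `p = 6 r²` and `c = 2 r²`, which are 3/2 and 1/2 of its square, integral.
evenFifthRoot : ∀ n → ∃[ r ] (2 * r) ^ 5 ≤ n × n < (2 * suc r) ^ 5
evenFifthRoot zero = 0 , z≤n , z<s
evenFifthRoot (suc n) with evenFifthRoot n
... | r , lo , hi with suc n <? (2 * suc r) ^ 5
...   | yes lt = r , m≤n⇒m≤1+n lo , lt
...   | no ≮   = suc r , ≮⇒≥ ≮ ,
  ≤-<-trans hi (^-monoˡ-< 5 (*-monoʳ-< 2 (n<1+n (suc r))))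

-- The bound `2 n^(2/5)` in integers, from `8 r² = 2 (2r)²` and `(2r)^5 ≤ n`.
threshold-≤ : ∀ n → 800 ^ 5 ≤ n → ∃[ q ] thresholdBias n ≤ q × q ^ 5 ≤ 32 * n ^ 2
threshold-≤ n 800⁵≤n with evenFifthRoot n
... | r , lo , hi =
  8 * (r * r) , proj₂ (thresholdBias-isLeast n) _ (bias-suffices 400≤r (<⇒≤ hi)) ,
  ≤-trans (≤-reflexive (eq r)) (*-monoʳ-≤ 32
    (≤-trans (*-mono-≤ lo lo) (≤-reflexive (cong (n *_) (sym (*-identityʳ n))))))
  where
  -- If `r < 400`, then `(2 * suc r) ^ 5` would be at most `800 ^ 5`, hence at most `n`.
  400≤r : 400 ≤ r
  400≤r = ≮⇒≥ λ r<400 → <-irrefl refl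
    (≤-<-trans 800⁵≤n (<-≤-trans hi (^-monoˡ-≤ 5 (*-monoʳ-≤ 2 r<400))))

  eq : ∀ r → (8 * (r * r)) ^ 5 ≡ 32 * ((2 * r) ^ 5 * (2 * r) ^ 5)
  eq r = trans (cong (_^ 5) (regroup r))
        (trans (*-^-distrib 2 (2 * r * (2 * r)) 5) (cong (32 *_) (*-^-distrib (2 * r) (2 * r) 5)))
    where
    regroup : ∀ r → 8 * (r * r) ≡ 2 * (2 * r * (2 * r))
    regroup = solve-∀

-- Comparison with the real constant

toℚ : ℕ → ℚ
toℚ m = ℤ.+ m ℚ./ 1

toℚᵘ-toℚ : ∀ m → ℚ.toℚᵘ (toℚ m) ℚᵘ.≃ (ℤ.+ m) ℚᵘ./ 1
toℚᵘ-toℚ m = ℚ.toℚᵘ-fromℚᵘ (ℚᵘ.mkℚᵘ (ℤ.+ m) 0)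

toℚ-mono : ∀ {a b} → a ≤ b → toℚ a ℚ.≤ toℚ b
toℚ-mono {a} {b} a≤b = ℚ.toℚᵘ-cancel-≤ (ℚᵘ.≤-trans (ℚᵘ.≤-reflexive (toℚᵘ-toℚ a))
  (ℚᵘ.≤-trans (ℚᵘ.*≤* (ℤ.*-monoʳ-≤-nonNeg (ℤ.+ 1) (ℤ.+≤+ a≤b)))
              (ℚᵘ.≤-reflexive (ℚᵘ.≃-sym (toℚᵘ-toℚ b)))))

toℚ-* : ∀ a b → toℚ (a * b) ≡ toℚ a ℚ.* toℚ b
toℚ-* a b = ℚ.toℚᵘ-injective (ℚᵘ.≃-trans (toℚᵘ-toℚ (a * b)) (ℚᵘ.≃-sym
  (ℚᵘ.≃-trans (ℚ.toℚᵘ-homo-* (toℚ a) (toℚ b))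
  (ℚᵘ.≃-trans (ℚᵘ.*-cong (toℚᵘ-toℚ a) (toℚᵘ-toℚ b))
              (ℚᵘ.*≡* (cong (ℤ._* ℤ.+ 1) (sym (ℤ.pos-* a b))))))))

toℚ-^ : ∀ a k → toℚ (a ^ k) ≡ toℚ a ^ℚ k
toℚ-^ a zero    = refl
toℚ-^ a (suc k) = trans (toℚ-* a (a ^ k)) (cong (toℚ a ℚ.*_) (toℚ-^ a k))

0≤toℚ : ∀ a → 0ℚ ℚ.≤ toℚ a
0≤toℚ a = toℚ-mono {0} {a} z≤n

*-mono-≤⁺ : ∀ {a b c d} → 0ℚ ℚ.≤ a → 0ℚ ℚ.≤ d → a ℚ.≤ b → c ℚ.≤ d → a ℚ.* c ℚ.≤ b ℚ.* d
*-mono-≤⁺ {a} {b} {c} {d} 0≤a 0≤d a≤b c≤d = ℚ.≤-trans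
  (ℚ.*-monoˡ-≤-nonNeg a {{ℚ.nonNegative 0≤a}} c≤d)
  (ℚ.*-monoʳ-≤-nonNeg d {{ℚ.nonNegative 0≤d}} a≤b)

*-nonNeg : ∀ {a b} → 0ℚ ℚ.≤ a → 0ℚ ℚ.≤ b → 0ℚ ℚ.≤ a ℚ.* b
*-nonNeg {a} {b} 0≤a 0≤b = subst (ℚ._≤ a ℚ.* b) (ℚ.*-zeroˡ 0ℚ) (*-mono-≤⁺ ℚ.≤-refl 0≤b 0≤a 0≤b)

^-nonNeg′ : ∀ {a} k → 0ℚ ℚ.≤ a → 0ℚ ℚ.≤ a ^ℚ k
^-nonNeg′ zero    0≤a = from-yes (0ℚ ℚ.≤? 1ℚ)
^-nonNeg′ (suc k) 0≤a = *-nonNeg 0≤a (^-nonNeg′ k 0≤a)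

^-mono-≤ : ∀ {a b} k → 0ℚ ℚ.≤ a → a ℚ.≤ b → a ^ℚ k ℚ.≤ b ^ℚ k
^-mono-≤ zero    0≤a a≤b = ℚ.≤-refl
^-mono-≤ (suc k) 0≤a a≤b =
  *-mono-≤⁺ 0≤a (^-nonNeg′ k (ℚ.≤-trans 0≤a a≤b)) a≤b (^-mono-≤ k 0≤a a≤b)

^-cancel-≤ : ∀ {a b} k → 0ℚ ℚ.≤ b → a ^ℚ suc k ℚ.≤ b ^ℚ suc k → a ℚ.≤ b
^-cancel-≤ {a} {b} k 0≤b aᵏ≤bᵏ = ℚ.≮⇒≥ λ b<a →
  let 0<a   = ℚ.≤-<-trans 0≤b b<a
      bᵏ<aᵏ = ℚ.≤-<-trans (ℚ.*-monoˡ-≤-nonNeg b {{ℚ.nonNegative 0≤b}} (^-mono-≤ k 0≤b (ℚ.<⇒≤ b<a)))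
                          (*-mono-<ˡ b<a (^-pos k 0<a))
  in ℚ.<-irrefl refl (ℚ.<-≤-trans bᵏ<aᵏ aᵏ≤bᵏ)
  where
  ^-pos : ∀ {a} k → 0ℚ ℚ.< a → 0ℚ ℚ.< a ^ℚ k
  ^-pos zero    0<a = ℚ.positive⁻¹ 1ℚ
  ^-pos (suc k) 0<a = *-pos 0<a (^-pos k 0<a)

-- The partial sum `1 + 1 + 1/2` is already sharp enough for the constant.
5/2≤ : ∀ {s} → euler <ᵁ s → ℤ.+ 5 ℚ./ 2 ℚ.≤ s
5/2≤ (u , expSum≤u , u<s) = ℚ.≤-trans (expSum≤u 2) (ℚ.<⇒≤ u<s)

-- 2 < 5 · 2^(-9/5) · (5/2)^(2/5), raised to the fifth power.
fifth-power-bound : ∀ {x y u v t} → 0ℚ ℚ.≤ y → 0ℚ ℚ.≤ u → 0ℚ ℚ.≤ v → 0ℚ ℚ.≤ t →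
  x ^ℚ 5 ℚ.≤ toℚ 32 ℚ.* y → ½ ^ℚ 9 ℚ.≤ u ^ℚ 5 → (ℤ.+ 5 ℚ./ 2) ^ℚ 2 ℚ.≤ v ^ℚ 5 → y ℚ.≤ t ^ℚ 5 →
  x ℚ.≤ toℚ 5 ℚ.* u ℚ.* v ℚ.* t
fifth-power-bound {x} {y} {u} {v} {t} 0≤y 0≤u 0≤v 0≤t x⁵≤ u⁵≥ v⁵≥ t⁵≥ =
  ^-cancel-≤ 4 (*-nonNeg (*-nonNeg (*-nonNeg (0≤toℚ 5) 0≤u) 0≤v) 0≤t) (begin
    x ^ℚ 5                                                 ≤⟨ x⁵≤ ⟩
    toℚ 32 ℚ.* y
      -- The product of the three constants is about 38.1.
      ≤⟨ *-mono-≤⁺ (0≤toℚ 32) 0≤y (from-yes (toℚ 32 ℚ.≤? toℚ 5 ^ℚ 5 ℚ.* ½ ^ℚ 9 ℚ.* (ℤ.+ 5 ℚ./ 2) ^ℚ 2)) ℚ.≤-refl ⟩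
    toℚ 5 ^ℚ 5 ℚ.* ½ ^ℚ 9 ℚ.* (ℤ.+ 5 ℚ./ 2) ^ℚ 2 ℚ.* y
      ≤⟨ *-mono-≤⁺ (from-yes (0ℚ ℚ.≤? toℚ 5 ^ℚ 5 ℚ.* ½ ^ℚ 9 ℚ.* (ℤ.+ 5 ℚ./ 2) ^ℚ 2)) (^-nonNeg′ 5 0≤t)
           (*-mono-≤⁺ (from-yes (0ℚ ℚ.≤? toℚ 5 ^ℚ 5 ℚ.* ½ ^ℚ 9)) (^-nonNeg′ 5 0≤v)
             (*-mono-≤⁺ (from-yes (0ℚ ℚ.≤? toℚ 5 ^ℚ 5)) (^-nonNeg′ 5 0≤u) ℚ.≤-refl u⁵≥) v⁵≥) t⁵≥ ⟩
    toℚ 5 ^ℚ 5 ℚ.* u ^ℚ 5 ℚ.* v ^ℚ 5 ℚ.* t ^ℚ 5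
      ≡⟨ cong (λ z → z ℚ.* v ^ℚ 5 ℚ.* t ^ℚ 5) (sym (^-distrib-* (toℚ 5) u 5)) ⟩
    (toℚ 5 ℚ.* u) ^ℚ 5 ℚ.* v ^ℚ 5 ℚ.* t ^ℚ 5
      ≡⟨ cong (ℚ._* t ^ℚ 5) (sym (^-distrib-* (toℚ 5 ℚ.* u) v 5)) ⟩
    (toℚ 5 ℚ.* u ℚ.* v) ^ℚ 5 ℚ.* t ^ℚ 5
      ≡⟨ sym (^-distrib-* (toℚ 5 ℚ.* u ℚ.* v) t 5) ⟩
    (toℚ 5 ℚ.* u ℚ.* v ℚ.* t) ^ℚ 5 ∎)
  where open ℚ.≤-Reasoning

theorem1p8 : (ε : ℚ) .{{_ : Positive ε}} →
    ∃[ N ] ((n : ℕ) → N ≤ n →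
    fromℕ (thresholdBias n) ≤ᴿ (C +ᴿ fromℚ ε {{pos⇒nonNeg ε}}) *ᴿ fromℕ n ^[ 2 / 5 ])
-- A rational `r` in the cut of the right-hand side unpacks into rationals `u`, `v`, `t` above the
-- powers of `1/2`, `e` and `n`; it remains to place the bias below `5 u v t`, and that below `r`.
theorem1p8 ε = 800 ^ 5 , λ n N≤n r
  (s , t′ ,
    (s₁ , s₂ ,
      (w , v′ ,
        (a , u′ , 5<a , (su , u , ½<su , 0<u , su⁹≤u⁵ , u<u′) , au′≤w) ,
        (sv , v , e<sv , 0<v , sv²≤v⁵ , v<v′) , wv′≤s₁) ,
      ε<s₂ , s₁+s₂≤s) ,
    (sn , t , n<sn , 0<t , sn²≤t⁵ , t<t′) , st′≤r) →
  let q , bias≤q , q⁵≤32n² = threshold-≤ n N≤n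
      0≤u = ℚ.<⇒≤ 0<u
      0≤v = ℚ.<⇒≤ 0<v
      0≤t = ℚ.<⇒≤ 0<t
      0≤v′ = ℚ.≤-trans 0≤v (ℚ.<⇒≤ v<v′)
      0≤u′ = ℚ.≤-trans 0≤u (ℚ.<⇒≤ u<u′)
      0<s₂ = ℚ.≤-<-trans (ℚ.nonNegative⁻¹ ε {{pos⇒nonNeg ε}}) ε<s₂
      0≤5u = *-nonNeg (0≤toℚ 5) 0≤u
      5u≤w = ℚ.≤-trans (*-mono-≤⁺ (0≤toℚ 5) 0≤u′ (ℚ.<⇒≤ 5<a) (ℚ.<⇒≤ u<u′)) au′≤w
      5uv≤s₁ = ℚ.≤-trans (*-mono-≤⁺ 0≤5u 0≤v′ 5u≤w (ℚ.<⇒≤ v<v′)) wv′≤s₁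
      -- The positive `s₂` makes this strict, as membership in an open cut demands.
      s₁<s = ℚ.<-≤-trans (subst (ℚ._< s₁ ℚ.+ s₂) (ℚ.+-identityʳ s₁) (ℚ.+-monoʳ-< s₁ 0<s₂)) s₁+s₂≤s
      5uv<s = ℚ.≤-<-trans 5uv≤s₁ s₁<s
      0≤s = ℚ.≤-trans (*-nonNeg 0≤5u 0≤v) (ℚ.<⇒≤ 5uv<s)
      n²≤t⁵ = ℚ.≤-trans (^-mono-≤ 2 (0≤toℚ n) (ℚ.<⇒≤ n<sn)) sn²≤t⁵
      x⁵≤ = subst₂ ℚ._≤_ (toℚ-^ q 5) (trans (toℚ-* 32 (n ^ 2)) (cong (toℚ 32 ℚ.*_) (toℚ-^ n 2)))
              (toℚ-mono q⁵≤32n²)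
      q≤5uvt = fifth-power-bound (^-nonNeg′ 2 (0≤toℚ n)) 0≤u 0≤v 0≤t x⁵≤
        (ℚ.≤-trans (^-mono-≤ 9 (from-yes (0ℚ ℚ.≤? ½)) (ℚ.<⇒≤ ½<su)) su⁹≤u⁵)
        (ℚ.≤-trans (^-mono-≤ 2 (from-yes (0ℚ ℚ.≤? ℤ.+ 5 ℚ./ 2)) (5/2≤ e<sv)) sv²≤v⁵)
        n²≤t⁵
      5uvt<st = *-mono-<ˡ 5uv<s 0<t
      st≤st′ = ℚ.*-monoˡ-≤-nonNeg s {{ℚ.nonNegative 0≤s}} (ℚ.<⇒≤ t<t′)
  in ℚ.≤-<-trans (ℚ.≤-trans (toℚ-mono bias≤q) q≤5uvt) (ℚ.<-≤-trans 5uvt<st (ℚ.≤-trans st≤st′ st′≤r))
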